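{- For all $n \ge 16$, $$N_{1,4}(n) = N_{1,4}(n-3)+N_{1,4}(n-5)+N_{1,4}(n-7)+N_{1,4}(n-8)+N_{1,4}(n-9)+N_{1,4}(n-10)+N_{1,4}(n-11)+N_{1,4}(n-13),$$ with initial values $N_{1,4}(n)=0$ for $n<5$ and $N_{1,4}(5)=1$, $N_{1,4}(6)=0$, $N_{1,4}(7)=1$, $N_{1,4}(8)=1$, $N_{1,4}(9)=1$, $N_{1,4}(10)=3$, $N_{1,4}(11)=2$, $N_{1,4}(12)=3$, $N_{1,4}(13)=6$, $N_{1,4}(14)=5$, $N_{1,4}(15)=10$.
   Context: For positive integers $a<b$ and $n \ge 3$, an $(a,b)$-necklace of length $n$ is a circular arrangement of the integers $0,1,\ldots,n-1$ (each used exactly once) such that any two adjacent entries have difference $\pm a$ or $\pm b$. Two necklaces are considered the same if one is obtained from the other by rotation or reflection. $N_{a,b}(n)$ denotes the number of distinct $(a,b)$-necklaces of length $n$; equivalently, it is the number of Hamiltonian cycles (as undirected subgraphs) of the graph on $\{0,1,\ldots,n-1\}$ in which $x,y$ are adjacent if and only if $|x-y| \in \{a,b\}$. -}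

module Defs where

open import Data.Fin.Base using (Fin; toℕ; opposite)
open import Data.Fin.Properties using (any?; all?) renaming (_≟_ to _≟ᶠ_)
open import Data.List.Base
  using (List; []; _∷_; allFin; cartesianProductWith; deduplicate; filter; length)
open import Data.Nat.Base using (ℕ; zero; suc; _+_; _≤_; ∣_-_∣)
open import Data.Nat.DivMod using (_mod_)
open import Data.Nat.Properties using (_≟_; _≤?_)
open import Data.Product.Base using (∃; _×_; _,_)
open import Data.Product using (∃!)
open import Data.Sum.Base using (_⊎_)
open import Data.Vec.Base using (Vec; []; _∷_; lookup)
open import Relation.Binary.Definitions using () renaming (Decidable to Decidable₂)
open import Relation.Binary.PropositionalEquality using (_≡_)
open import Relation.Nullary.Decidable using (Dec; map′; _×-dec_; _⊎-dec_; _→-dec_)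
open import Relation.Unary using (Decidable)

infixl 6 _⊕_
infix 4 _≈_ _≈?_

_⊕_ : ∀ {n} → Fin n → ℕ → Fin n
_⊕_ {suc m} i k = (toℕ i + k) mod suc m

-- v lists the entries of a circular arrangement read off from some starting
-- point in some direction: position i is followed by position i ⊕ 1, and the
-- last position by the first.
Arrangement : ℕ → Set
Arrangement n = Vec (Fin n) n

UsesEachOnce : ∀ {n} → Arrangement n → Set
UsesEachOnce v = ∀ x → ∃! _≡_ λ i → lookup v i ≡ x

-- x - y is one of ±a, ±b.
Compatible : ∀ {n} → ℕ → ℕ → Fin n → Fin n → Set
Compatible a b x y = (∣ toℕ x - toℕ y ∣ ≡ a) ⊎ (∣ toℕ x - toℕ y ∣ ≡ b)

-- Necklaces have length at least 3.  Without the first condition the cyclic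
-- reading of lengths 0 and 2 would produce degenerate "necklaces".
record IsNecklace (a b : ℕ) {n : ℕ} (v : Arrangement n) : Set where
  constructor isNecklace
  field
    length≥3     : 3 ≤ n
    usesEachOnce : UsesEachOnce v
    adjacent     : ∀ i → Compatible a b (lookup v i) (lookup v (i ⊕ 1))

-- Every element of the dihedral group acting on the n positions is either a
-- rotation, i ↦ i + k, or a rotation after the reflection i ↦ n - 1 - i.
_≈_ : ∀ {n} → Arrangement n → Arrangement n → Set
_≈_ {n} v w = ∃ λ (k : Fin n) →
    (∀ i → lookup w i ≡ lookup v (i ⊕ toℕ k))
  ⊎ (∀ i → lookup w i ≡ lookup v (opposite i ⊕ toℕ k))

usesEachOnce? : ∀ {n} → Decidable (UsesEachOnce {n})
usesEachOnce? v = all? λ x →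
  map′ (λ (i , p , u) → i , p , λ {j} → u j)
       (λ (i , p , u) → i , p , λ j → u {j})
       (any? λ i → (lookup v i ≟ᶠ x)
                   ×-dec all? λ j → (lookup v j ≟ᶠ x) →-dec (i ≟ᶠ j))

compatible? : ∀ {n} a b → Decidable₂ (Compatible {n} a b)
compatible? a b x y =
  (∣ toℕ x - toℕ y ∣ ≟ a) ⊎-dec (∣ toℕ x - toℕ y ∣ ≟ b)

isNecklace? : ∀ a b {n} → Decidable (IsNecklace a b {n})
isNecklace? a b {n} v =
  map′ (λ (l , u , c) → isNecklace l u c)
       (λ (isNecklace l u c) → l , u , c)
       ((3 ≤? n)
        ×-dec usesEachOnce? v
        ×-dec all? λ i → compatible? a b (lookup v i) (lookup v (i ⊕ 1)))

_≈?_ : ∀ {n} → Decidable₂ (_≈_ {n})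
v ≈? w = any? λ k →
        (all? λ i → lookup w i ≟ᶠ lookup v (i ⊕ toℕ k))
  ⊎-dec (all? λ i → lookup w i ≟ᶠ lookup v (opposite i ⊕ toℕ k))

-- Each vector of length k over Fin n, listed exactly once.
allVecs : ∀ n k → List (Vec (Fin n) k)
allVecs n zero    = [] ∷ []
allVecs n (suc k) = cartesianProductWith _∷_ (allFin n) (allVecs n k)

-- The number of ≈-classes of necklaces: deduplicate keeps one representative
-- of each class.
N : (a b n : ℕ) → ℕ
N a b n = length (deduplicate _≈?_ (filter (isNecklace? a b) (allVecs n n)))

{-# OPTIONS --safe #-}
module Submission where

-- Delete the entry 0 from a necklace, join its two neighbours p and q, and lower
-- every other entry by 1.  The result is a necklace one shorter, except that p - 1
-- and q - 1 are now adjacent by decree.  Keeping the set S of such decreed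
-- adjacencies ("links") as a state turns this into a bijection: the necklaces on
-- n + 1 entries with links S are partitioned by {p , q}, and each part is in
-- bijection with the necklaces on n entries with links S′, where S′ is S shifted
-- down together with {p - 1 , q - 1}.  Links only involve 0, ..., 3 and starting from
-- S = ∅ just twelve sets occur, so the counts satisfy a finite linear system.  With
-- A, C, D counting from ∅, {02}, {23}, eliminating the other states leaves
--   A (n+2) = C n + D n,   C (n+5) = A (n+4) + C n,   D (n+3) = A n + D (n+1),
-- and the recurrence follows by unfolding C (n+11) + D (n+11).

open import Defs
open import Data.Bool.Base using (if_then_else_)
open import Data.Fin.Base as Fin using (Fin; toℕ; fromℕ<; opposite)
open import Data.Fin.Properties
  using (toℕ<n; toℕ-injective; toℕ-fromℕ<; opposite-prop; opposite-involutive)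
open import Data.List.Base
  using (List; []; _∷_; _++_; _∷ʳ_; [_]; length; map; reverse; take; drop; deduplicate;
         upTo; cartesianProduct; initLast; _∷ʳ′_)
open import Data.List.Properties
  using (++-assoc; ++-identityʳ; length-++; length-map; length-reverse; length-take; map-++;
         reverse-++; reverse-map; reverse-involutive; unfold-reverse; take++drop≡id;
         ∷-injectiveˡ; ∷-injectiveʳ; ∷ʳ-injectiveʳ; ∷ʳ-++)
open import Data.List.Membership.DecPropositional using (_∈?_)
open import Data.List.Membership.Propositional using (_∈_; _∉_; find; lose)
open import Data.List.Membership.Propositional.Properties
  using (∈-∃++; ∈-++⁺ʳ; ∈-++⁻; ∈-map⁺; ∈-map⁻; ∈-filter⁺; ∈-upTo⁺; ∈-cartesianProduct⁺;
         ∈-cartesianProductWith⁺; ∈-allFin)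
open import Data.List.Relation.Binary.Permutation.Propositional
  using (_↭_; ↭-sym; ↭-trans; ↭⇒↭ₛ)
open import Data.List.Relation.Binary.Permutation.Propositional.Properties
  using (++-comm; ↭-reverse; ↭-length; All-resp-↭; ∈-resp-↭)
import Data.List.Relation.Binary.Permutation.Setoid.Properties as ↭ₛ
open import Data.List.Relation.Binary.Pointwise.Base using (Pointwise; []; _∷_)
open import Data.List.Relation.Unary.All as All using (All; []; _∷_)
import Data.List.Relation.Unary.All.Properties as All
open import Data.List.Relation.Unary.AllPairs using (AllPairs; []; _∷_)
import Data.List.Relation.Unary.AllPairs.Properties as AllPairs
open import Data.List.Relation.Unary.Any as Any using (Any; here; there)
import Data.List.Relation.Unary.Any.Properties as Any
open import Data.List.Relation.Unary.Unique.Propositional using (Unique)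
open import Data.List.Relation.Unary.Unique.Propositional.Properties
  using (Unique[x∷xs]⇒x∉xs; upTo⁺; cartesianProduct⁺)
  renaming (map⁺ to Unique-map⁺; map⁻ to Unique-map⁻)
open import Data.Nat.Base
  using (ℕ; zero; suc; _+_; _∸_; _≤_; _<_; z≤n; s≤s; z<s; s<s; s<s⁻¹; ∣_-_∣)
open import Data.Nat.DivMod using (_%_; m%n<n; m<n⇒m%n≡m; n%n≡0; [m+n]%n≡m%n)
open import Data.Nat.ListAction using (sum)
open import Data.Nat.Properties
  using (_≟_; _<?_; <-cmp; ≤-refl; ≤-reflexive; ≤-trans; ≤-antisym; <-irrefl; <⇒≤; <⇒≯;
         n≤1+n; m<m+n; m≤n+m; m≤n⇒m<n∨m≡n; m≤n⇒m⊓n≡m; suc-injective; +-assoc; +-comm;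
         +-identityʳ; +-suc; +-monoˡ-<; m+[n∸m]≡n; ∣-∣-comm)
open import Data.Nat.Solver using (module +-*-Solver)
open import Data.Product.Base using (∃; ∃₂; _×_; _,_; proj₁; proj₂)
open import Data.Product.Properties using (≡-dec)
open import Data.Sum.Base as Sum using (_⊎_; inj₁; inj₂; [_,_]′)
open import Data.Vec.Base using (Vec; []; _∷_; lookup; tabulate)
open import Data.Vec.Properties using (lookup∘tabulate)
open import Function.Base using (_∘_)
open import Level using (0ℓ)
open import Relation.Binary.Core using (Rel)
open import Relation.Binary.Definitions using (tri<; tri≈; tri>)
  renaming (Decidable to Decidable₂)
open import Relation.Binary.PropositionalEquality
  using (_≡_; _≢_; refl; sym; trans; cong; cong₂; subst; subst₂; setoid)
open import Relation.Binary.Structures using (IsEquivalence)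
open import Relation.Nullary
  using (¬_; Dec; yes; no; does; contradiction; ¬?; _×-dec_; _⊎-dec_; _→-dec_)
open import Relation.Nullary.Decidable using (map′)
open import Relation.Unary using (Pred; _⊆_)

-- Counting up to an equivalence relation

-- Exactly `k` classes of `_~_` meet `P`. Stating this as a relation between `P` and `k` lets counts
-- be carried along bijections of classes.
record Enumerates {A : Set} (_~_ : Rel A 0ℓ) (P : Pred A 0ℓ) (k : ℕ) : Set where
  field
    reps     : List A
    card     : length reps ≡ k
    sound    : All P reps
    apart    : AllPairs (λ x y → ¬ (x ~ y)) reps
    complete : ∀ {x} → P x → Any (x ~_) reps

open Enumerates

module _ {A : Set} {_~_ : Rel A 0ℓ} (eq : IsEquivalence _~_) where
  open IsEquivalence eq renaming (refl to ~-refl; sym to ~-sym; trans to ~-trans) using ()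

  -- A pigeonhole argument: the `y` matched with `x` is removed from `ys`, and no later element of
  -- `xs` can need it, since it would be equivalent to `x` through `y`.
  apart⇒length-≤ : ∀ {xs ys} → AllPairs (λ x y → ¬ (x ~ y)) xs →
                   All (λ x → Any (x ~_) ys) xs → length xs ≤ length ys
  apart⇒length-≤ []              []              = z≤n
  apart⇒length-≤ (x≁xs ∷ apart) (x~ys ∷ xs~ys)
    with y , y∈ys , x~y ← find x~ys
    with us , vs , refl ← ∈-∃++ y∈ys
    = ≤-trans
        (s≤s (apart⇒length-≤ apart (All.zipWith (λ (≁ , ~) → avoid ≁ ~) (x≁xs , xs~ys))))
        (≤-reflexive (trans (cong ℕ.suc (length-++ us))
          (trans (sym (+-suc (length us) (length vs))) (sym (length-++ us)))))
    where
    avoid : ∀ {z} → ¬ (_ ~ z) → Any (z ~_) (us ++ y ∷ vs) → Any (z ~_) (us ++ vs)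
    avoid x≁z p with Any.++⁻ us p
    ... | inj₁ q           = Any.++⁺ˡ q
    ... | inj₂ (here z~y)  = contradiction (~-trans x~y (~-sym z~y)) x≁z
    ... | inj₂ (there q)   = Any.++⁺ʳ us q

  Enumerates-unique : ∀ {P k l} → Enumerates _~_ P k → Enumerates _~_ P l → k ≡ l
  Enumerates-unique E F =
    trans (sym (card E)) (trans (≤-antisym (bound E F) (bound F E)) (card F))
    where
    bound : ∀ {P k l} (E : Enumerates _~_ P k) (F : Enumerates _~_ P l) →
            length (reps E) ≤ length (reps F)
    bound E F = apart⇒length-≤ (apart E) (All.map (complete F) (sound E))

  module _ (_~?_ : Decidable₂ _~_) where

    deduplicate-apart : ∀ xs → AllPairs (λ x y → ¬ (x ~ y)) (deduplicate _~?_ xs)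
    deduplicate-apart []       = []
    deduplicate-apart (x ∷ xs) =
      All.all-filter (¬? ∘ (x ~?_)) (deduplicate _~?_ xs) ∷
      AllPairs.filter⁺ (¬? ∘ (x ~?_)) (deduplicate-apart xs)

    deduplicate-covers : ∀ {x} xs → x ∈ xs → Any (x ~_) (deduplicate _~?_ xs)
    deduplicate-covers (x ∷ xs) (here refl) = here ~-refl
    deduplicate-covers {z} (x ∷ xs) (there p) with z ~? x
    ... | yes z~x = here z~x
    ... | no  z≁x with y , y∈ , z~y ← find (deduplicate-covers xs p) =
      -- The representative `y` of `z` survives the filter: `x ~ y` would give `z ~ x`.
      there (lose (∈-filter⁺ (¬? ∘ (x ~?_)) y∈ (λ x~y → z≁x (~-trans z~y (~-sym x~y)))) z~y)

    deduplicate-enumerates : ∀ {P xs} → All P xs → (∀ {x} → P x → x ∈ xs) →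
                             Enumerates _~_ P (length (deduplicate _~?_ xs))
    deduplicate-enumerates {P} {xs} sound complete = record
      { reps     = deduplicate _~?_ xs
      ; card     = refl
      ; sound    = All.deduplicate⁺ _~?_ sound
      ; apart    = deduplicate-apart xs
      ; complete = deduplicate-covers xs ∘ complete
      }

Enumerates-∅ : ∀ {A : Set} {_~_ : Rel A 0ℓ} {P} → (∀ {x} → ¬ P x) → Enumerates _~_ P 0
Enumerates-∅ ¬P = record
  { reps = [] ; card = refl ; sound = [] ; apart = [] ; complete = λ p → contradiction p ¬P }

Enumerates-if : ∀ {A Q : Set} {_~_ : Rel A 0ℓ} {P k} (Q? : Dec Q) → (∀ {x} → P x → Q) →
                (Q → Enumerates _~_ P k) → Enumerates _~_ P (if does Q? then k else 0)
Enumerates-if (yes q) P⇒Q E = E q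
Enumerates-if (no ¬q) P⇒Q E = Enumerates-∅ (¬q ∘ P⇒Q)

-- `disjoint` is stated up to `_~_`: no class meets two parts, so the representatives of different
-- parts stay apart when concatenated. Uniqueness of `is` keeps a part from being counted twice.
Enumerates-⋃ : ∀ {A I : Set} {_~_ : Rel A 0ℓ} {P : I → Pred A 0ℓ} {k : I → ℕ} →
               (∀ {i j x y} → P i x → P j y → x ~ y → i ≡ j) →
               (∀ i → Enumerates _~_ (P i) (k i)) →
               ∀ {is} → Unique is →
               Enumerates _~_ (λ x → Any (λ i → P i x) is) (sum (map k is))
Enumerates-⋃ {P = P} disjoint E {[]}     []          = Enumerates-∅ λ ()
Enumerates-⋃ {P = P} disjoint E {i ∷ is} (i∉is ∷ is!) = record
  { reps     = reps (E i) ++ reps F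
  ; card     = trans (length-++ (reps (E i))) (cong₂ _+_ (card (E i)) (card F))
  ; sound    = All.++⁺ (All.map here (sound (E i))) (All.map there (sound F))
  ; apart    = AllPairs.++⁺ (apart (E i)) (apart F)
      (All.map (λ p → All.map (λ q x~y → separate p q x~y) (sound F)) (sound (E i)))
  ; complete = λ where
      (here p)  → Any.++⁺ˡ (complete (E i) p)
      (there p) → Any.++⁺ʳ (reps (E i)) (complete F p)
  }
  where
  F = Enumerates-⋃ disjoint E is!
  separate : ∀ {x y} → P i x → Any (λ j → P j y) is → ¬ _
  separate p q x~y with j , j∈is , r ← find q = All.lookup i∉is j∈is (disjoint p r x~y)

module _ {A B : Set} {_~₁_ : Rel A 0ℓ} {_~₂_ : Rel B 0ℓ} {P : Pred A 0ℓ} {Q : Pred B 0ℓ}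
         (eq : IsEquivalence _~₂_) (f : A → B)
         (f-P    : ∀ {x} → P x → Q (f x))
         (f-cong : ∀ {x y} → P x → P y → x ~₁ y → f x ~₂ f y)
         (f-inj  : ∀ {x y} → P x → P y → f x ~₂ f y → x ~₁ y)
         (f-surj : ∀ {w} → Q w → ∃ λ x → P x × f x ~₂ w) where
  open IsEquivalence eq using () renaming (sym to ~-sym; trans to ~-trans)

  private
    Over : A → B → Set
    Over x w = P x × f x ~₂ w

    lifts : ∀ {ws} → All Q ws → ∃ λ xs → Pointwise Over xs ws
    lifts []       = [] , []
    lifts (q ∷ qs) with x , over ← f-surj q | xs , overs ← lifts qs = x ∷ xs , over ∷ overs

    lifts-size : ∀ {xs ws} → Pointwise Over xs ws → length xs ≡ length ws
    lifts-size []       = refl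
    lifts-size (_ ∷ os) = cong ℕ.suc (lifts-size os)

    lifts-sound : ∀ {xs ws} → Pointwise Over xs ws → All P xs
    lifts-sound []             = []
    lifts-sound ((p , _) ∷ os) = p ∷ lifts-sound os

    lifts-apart : ∀ {xs ws} → Pointwise Over xs ws →
                  AllPairs (λ w w′ → ¬ (w ~₂ w′)) ws → AllPairs (λ x y → ¬ (x ~₁ y)) xs
    lifts-apart []       []             = []
    lifts-apart ((p , fx~w) ∷ os) (w≁ws ∷ ≁ws) = go os w≁ws ∷ lifts-apart os ≁ws
      where
      go : ∀ {xs ws} → Pointwise Over xs ws → All (λ w′ → ¬ (_ ~₂ w′)) ws →
           All (λ y → ¬ (_ ~₁ y)) xs
      go []                   []         = []
      go ((q , fy~w′) ∷ os) (≁ ∷ ≁s) =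
        (λ x~y → ≁ (~-trans (~-sym fx~w) (~-trans (f-cong p q x~y) fy~w′))) ∷ go os ≁s

    lifts-complete : ∀ {xs ws x} → P x → Pointwise Over xs ws → Any (f x ~₂_) ws → Any (x ~₁_) xs
    lifts-complete p ((q , fy~w) ∷ os) (here fx~w) = here (f-inj p q (~-trans fx~w (~-sym fy~w)))
    lifts-complete p (_ ∷ os)          (there a)   = there (lifts-complete p os a)

  -- `f` induces a bijection between the classes of `P` and those of `Q`. Representatives for `Q`
  -- are lifted through `f-surj`; `f-cong` keeps the lifts apart and `f-inj` makes them complete.
  Enumerates-pullback : ∀ {k} → Enumerates _~₂_ Q k → Enumerates _~₁_ P k
  Enumerates-pullback E with xs , os ← lifts (sound E) = record
    { reps     = xs
    ; card     = trans (lifts-size os) (card E)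
    ; sound    = lifts-sound os
    ; apart    = lifts-apart os (apart E)
    ; complete = λ p → lifts-complete p os (complete E (f-P p))
    }

Enumerates-⇔ : ∀ {A : Set} {_~_ : Rel A 0ℓ} {P Q k} → P ⊆ Q → Q ⊆ P →
               Enumerates _~_ P k → Enumerates _~_ Q k
Enumerates-⇔ P⊆Q Q⊆P E = record
  { reps     = reps E
  ; card     = card E
  ; sound    = All.map P⊆Q (sound E)
  ; apart    = apart E
  ; complete = λ q → complete E (Q⊆P q)
  }

private variable
  A : Set
  a b x y z : A
  xs ys zs us vs ws : List A

-- Cyclic lists up to rotation and reflection

infix 4 _≈ᵣ_ _~_

data _≈ᵣ_ {A : Set} : List A → List A → Set where
  rotate : ∀ xs ys → (xs ++ ys) ≈ᵣ (ys ++ xs)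

data _~_ {A : Set} (xs ys : List A) : Set where
  rotation   : xs ≈ᵣ ys → xs ~ ys
  reflection : xs ≈ᵣ reverse ys → xs ~ ys

-- Of two cuts of the same list one lies to the left of the other; `us` is the segment between them.
++-split : ∀ (ws xs ys zs : List A) → ws ++ xs ≡ ys ++ zs →
           (∃ λ us → ys ≡ ws ++ us × xs ≡ us ++ zs) ⊎
           (∃ λ us → ws ≡ ys ++ us × zs ≡ us ++ xs)
++-split []       xs ys       zs eq = inj₁ (ys , refl , eq)
++-split (w ∷ ws) xs []       zs eq = inj₂ (w ∷ ws , refl , sym eq)
++-split (w ∷ ws) xs (y ∷ ys) zs eq with ∷-injectiveˡ eq | ++-split ws xs ys zs (∷-injectiveʳ eq)
... | refl | inj₁ (us , refl , e) = inj₁ (us , refl , e)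
... | refl | inj₂ (us , refl , e) = inj₂ (us , refl , e)

≈ᵣ-refl : xs ≈ᵣ xs
≈ᵣ-refl {xs = xs} = subst (_≈ᵣ xs) (++-identityʳ xs) (rotate xs [])

≈ᵣ-sym : xs ≈ᵣ ys → ys ≈ᵣ xs
≈ᵣ-sym (rotate xs ys) = rotate ys xs

-- The second cut falls inside `ys` or inside `xs`. Either way there are three segments, and the
-- composite exchanges one of them with the other two.
≈ᵣ-trans : xs ≈ᵣ ys → ys ≈ᵣ zs → xs ≈ᵣ zs
≈ᵣ-trans (rotate xs ys) q = go q refl
  where
  go : ∀ {us vs} → us ≈ᵣ vs → us ≡ ys ++ xs → xs ++ ys ≈ᵣ vs
  go (rotate us vs) eq with ++-split us vs ys xs eq
  ... | inj₁ (ts , refl , refl) =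
        subst (xs ++ us ++ ts ≈ᵣ_) (sym (++-assoc ts xs us))
          (subst (_≈ᵣ ts ++ xs ++ us) (++-assoc xs us ts) (rotate (xs ++ us) ts))
  ... | inj₂ (ts , refl , refl) =
        subst (_≈ᵣ vs ++ ys ++ ts) (sym (++-assoc ts vs ys))
          (subst (ts ++ vs ++ ys ≈ᵣ_) (++-assoc vs ys ts) (rotate ts (vs ++ ys)))

≈ᵣ-reverse : xs ≈ᵣ ys → reverse xs ≈ᵣ reverse ys
≈ᵣ-reverse (rotate xs ys)
  rewrite reverse-++ xs ys | reverse-++ ys xs = rotate (reverse ys) (reverse xs)

≈ᵣ-reverse⁻ : reverse xs ≈ᵣ ys → xs ≈ᵣ reverse ys
≈ᵣ-reverse⁻ {xs = xs} p = subst (_≈ᵣ _) (reverse-involutive xs) (≈ᵣ-reverse p)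

~-refl : xs ~ xs
~-refl = rotation ≈ᵣ-refl

~-reflexive : xs ≡ ys → xs ~ ys
~-reflexive refl = ~-refl

~-sym : xs ~ ys → ys ~ xs
~-sym (rotation p) = rotation (≈ᵣ-sym p)
~-sym (reflection p) = reflection (≈ᵣ-reverse⁻ (≈ᵣ-sym p))

~-trans : xs ~ ys → ys ~ zs → xs ~ zs
~-trans (rotation p) (rotation q) = rotation (≈ᵣ-trans p q)
~-trans (rotation p) (reflection q) = reflection (≈ᵣ-trans p q)
~-trans (reflection p) (rotation q) = reflection (≈ᵣ-trans p (≈ᵣ-reverse q))
~-trans (reflection p) (reflection q) =
  rotation (≈ᵣ-trans p (subst (_ ≈ᵣ_) (reverse-involutive _) (≈ᵣ-reverse q)))

~-reverse : xs ~ reverse xs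
~-reverse {xs = xs} = ~-sym (reflection ≈ᵣ-refl)

≈ᵣ⇒↭ : xs ≈ᵣ ys → xs ↭ ys
≈ᵣ⇒↭ (rotate xs ys) = ++-comm xs ys

~⇒↭ : xs ~ ys → xs ↭ ys
~⇒↭ (rotation p) = ≈ᵣ⇒↭ p
~⇒↭ (reflection p) = ↭-trans (≈ᵣ⇒↭ p) (↭-reverse _)

reverse-∷-∷ʳ : ∀ (x : A) xs y → reverse (x ∷ xs ∷ʳ y) ≡ y ∷ reverse xs ∷ʳ x
reverse-∷-∷ʳ x xs y =
  trans (unfold-reverse x (xs ∷ʳ y)) (cong (_∷ʳ x) (reverse-++ xs [ y ]))

-- `z` occurs in `z ∷ us` at the front only, so a rotation that keeps `z` in front is trivial.
≈ᵣ-cancel : z ∉ us → z ∷ us ≈ᵣ z ∷ vs → us ≡ vs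
≈ᵣ-cancel {z = z} {us} {vs} z∉us p = go p refl refl
  where
  go : xs ≈ᵣ ys → xs ≡ z ∷ us → ys ≡ z ∷ vs → us ≡ vs
  go (rotate []       ys)       refl e =
    ∷-injectiveʳ (trans (sym (++-identityʳ ys)) e)
  go (rotate (z ∷ xs) [])       refl refl = ++-identityʳ xs
  go (rotate (z ∷ xs) (y ∷ ys)) refl refl =
    contradiction (∈-++⁺ʳ xs (here refl)) z∉us

~-cancel : z ∉ us → z ∷ us ~ z ∷ vs → us ≡ vs ⊎ us ≡ reverse vs
~-cancel z∉us (rotation p) = inj₁ (≈ᵣ-cancel z∉us p)
~-cancel {z = z} {us} {vs} z∉us (reflection p) = inj₂ (≈ᵣ-cancel z∉us
  (≈ᵣ-trans p (subst (_≈ᵣ z ∷ reverse vs) (sym (unfold-reverse z vs)) (rotate (reverse vs) [ z ]))))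

-- Cyclic adjacency

-- Some reading of the cycle starts with `x` and ends with `y`. Phrased through `_~_`, adjacency is
-- invariant under rotation and reflection at once.
Adj : List A → A → A → Set
Adj xs x y = ∃ λ m → xs ~ x ∷ m ∷ʳ y

Adj-sym : Adj xs x y → Adj xs y x
Adj-sym {x = x} {y} (m , p) = reverse m , ~-trans p
  (subst (x ∷ m ∷ʳ y ~_) (reverse-∷-∷ʳ x m y) ~-reverse)

Adj-resp-~ : xs ~ ys → Adj xs x y → Adj ys x y
Adj-resp-~ p (m , q) = m , ~-trans (~-sym p) q

Adj-head : Adj (z ∷ us) z x → z ∉ us → (∃ λ m → us ≡ m ∷ʳ x) ⊎ (∃ λ m → us ≡ x ∷ m)
Adj-head {x = x} (m , p) z∉us with ~-cancel z∉us p
... | inj₁ e = inj₁ (m , e)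
... | inj₂ e = inj₂ (reverse m , trans e (reverse-++ m [ x ]))

Adj-head-inv : z ∉ (a ∷ us ∷ʳ b) → Adj (z ∷ a ∷ us ∷ʳ b) z x → x ≡ a ⊎ x ≡ b
Adj-head-inv {a = a} {us} z∉ adj with Adj-head adj z∉
... | inj₁ (m , e) = inj₂ (sym (∷ʳ-injectiveʳ (a ∷ us) m e))
... | inj₂ (m , e) = inj₁ (sym (∷-injectiveˡ e))

data Consecutive {A : Set} (x y : A) : List A → Set where
  infix-of : ∀ us vs → Consecutive x y (us ++ x ∷ y ∷ vs)

Consecutive⇒Adj : Consecutive x y xs → Adj xs x y
-- Cutting between `x` and `y` yields a reading that starts with `y` and ends with `x`, hence
-- `Adj-sym`.
Consecutive⇒Adj {x = x} {y} (infix-of us vs) = Adj-sym (vs ++ us , rotation (≈ᵣ-trans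
  (subst (_≈ᵣ (y ∷ vs) ++ us ∷ʳ x) (∷ʳ-++ us x (y ∷ vs)) (rotate (us ∷ʳ x) (y ∷ vs)))
  (subst (((y ∷ vs) ++ us ∷ʳ x) ≈ᵣ_) (cong (y ∷_) (sym (++-assoc vs us [ x ]))) ≈ᵣ-refl)))

Adj-∷-∷ʳ : ∀ (x : A) m y → Adj (x ∷ m ∷ʳ y) x y
Adj-∷-∷ʳ x m y = m , ~-refl

ends : ∀ (x y a b : A) {m n} → x ∷ m ∷ʳ y ≡ a ∷ n ∷ʳ b → x ≡ a × y ≡ b
ends x y a b {m} {n} e = ∷-injectiveˡ e , ∷ʳ-injectiveʳ (x ∷ m) (a ∷ n) e

-- Either the rotation is trivial and the ends agree, or the place where the end `y` of the new
-- reading meets its start `x` lies inside the old one.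
≈ᵣ-consecutive : ∀ {m n : List A} → a ∷ m ∷ʳ b ≈ᵣ x ∷ n ∷ʳ y →
                 Consecutive y x (a ∷ m ∷ʳ b) ⊎ (x ≡ a × y ≡ b)
≈ᵣ-consecutive {A} {a} {b} {x} {y} {m} {n} p = go p refl refl
  where
  go : ∀ {us vs : List A} → us ≈ᵣ vs → us ≡ a ∷ m ∷ʳ b → vs ≡ x ∷ n ∷ʳ y →
       Consecutive y x us ⊎ (x ≡ a × y ≡ b)
  go (rotate [] vs) e f =
    inj₂ (ends x y a b (trans (sym f) (trans (++-identityʳ vs) e)))
  go (rotate (u ∷ us) []) e f =
    inj₂ (ends x y a b (trans (sym f) (trans (sym (++-identityʳ (u ∷ us))) e)))
  go (rotate (u ∷ us) (v ∷ vs)) e f with ++-split (v ∷ vs) (u ∷ us) (x ∷ n) [ y ] f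
  ... | inj₁ (ts , g , h) with ∷-injectiveˡ g
  ...   | refl = inj₁ (subst (Consecutive y x)
            (trans (sym (∷ʳ-++ ts y (x ∷ vs))) (cong (_++ x ∷ vs) (sym h))) (infix-of ts vs))
  go (rotate (u ∷ us) (v ∷ vs)) e f | inj₂ ([] , g , refl) with ∷-injectiveˡ g
  ...   | refl = inj₁ (infix-of [] vs)
  go (rotate (u ∷ us) (v ∷ vs)) e f | inj₂ (t ∷ [] , g , ())
  go (rotate (u ∷ us) (v ∷ vs)) e f | inj₂ (t ∷ t′ ∷ ts , g , ())

Adj-cases : ∀ {m : List A} → Adj (a ∷ m ∷ʳ b) x y →
            (Consecutive x y (a ∷ m ∷ʳ b) ⊎ Consecutive y x (a ∷ m ∷ʳ b)) ⊎
            ((x ≡ a × y ≡ b) ⊎ (y ≡ a × x ≡ b))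
Adj-cases (n , rotation p) with ≈ᵣ-consecutive p
... | inj₁ c = inj₁ (inj₂ c)
... | inj₂ e = inj₂ (inj₁ e)
Adj-cases {x = x} {y} (n , reflection p) with ≈ᵣ-consecutive (subst (_ ≈ᵣ_) (reverse-∷-∷ʳ x n y) p)
... | inj₁ c = inj₁ (inj₁ c)
... | inj₂ e = inj₂ (inj₂ e)

∈⇒~∷ : x ∈ xs → ∃ λ us → xs ~ x ∷ us
∈⇒~∷ {x = x} p with us , vs , refl ← ∈-∃++ p = vs ++ us , rotation (rotate us (x ∷ vs))

∷-∷ʳ-view : ∀ (xs : List A) → 2 ≤ length xs → ∃₂ λ a m → ∃ λ b → xs ≡ a ∷ m ∷ʳ b
∷-∷ʳ-view (x ∷ xs) 2≤ with initLast xs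
∷-∷ʳ-view (x ∷ .[])       (s≤s ()) | []
∷-∷ʳ-view (x ∷ .(m ∷ʳ y)) 2≤       | m ∷ʳ′ y = x , m , y , refl

~-isEquivalence : ∀ {A : Set} → IsEquivalence (_~_ {A})
~-isEquivalence = record { refl = ~-refl ; sym = ~-sym ; trans = ~-trans }

~-reverse-tail : ∀ {A : Set} (z : A) us → z ∷ us ~ z ∷ reverse us
~-reverse-tail z us = ~-trans ~-reverse
  (subst (_~ z ∷ reverse us) (sym (unfold-reverse z us)) (rotation (rotate (reverse us) [ z ])))

Unique-resp-↭ : ∀ {A : Set} {xs ys : List A} → xs ↭ ys → Unique xs → Unique ys
Unique-resp-↭ p = ↭ₛ.Unique-resp-↭ (setoid _) (↭⇒↭ₛ p)

-- Necklaces with prescribed adjacencies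

Links : Set
Links = List (ℕ × ℕ)

Link : Links → ℕ → ℕ → Set
Link S x y = (x , y) ∈ S ⊎ (y , x) ∈ S

Near : ℕ → ℕ → Set
Near x y = ∣ x - y ∣ ≡ 1 ⊎ ∣ x - y ∣ ≡ 4

Allowed : Links → ℕ → ℕ → Set
Allowed S x y = Link S x y ⊎ Near x y

-- A link both permits an adjacency and enforces it. With no links and `n` at least 3 these are the
-- (1,4)-necklaces as lists of numbers.
record Linked (S : Links) (n : ℕ) (xs : List ℕ) : Set where
  field
    size     : length xs ≡ n
    unique   : Unique xs
    bounded  : All (_< n) xs
    covers   : ∀ {i} → i < n → i ∈ xs
    allowed  : ∀ {x y} → Adj xs x y → Allowed S x y
    required : ∀ {x y} → Link S x y → Adj xs x y

open Linked

Link-sym : ∀ {S x y} → Link S x y → Link S y x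
Link-sym = Sum.swap

Allowed-sym : ∀ {S} x y → Allowed S x y → Allowed S y x
Allowed-sym {S} x y = Sum.map (Link-sym {S}) (subst (λ d → d ≡ 1 ⊎ d ≡ 4) (∣-∣-comm x y))

Linked-resp-~ : ∀ {S n xs ys} → xs ~ ys → Linked S n xs → Linked S n ys
Linked-resp-~ p L = record
  { size     = trans (sym (↭-length (~⇒↭ p))) (size L)
  ; unique   = Unique-resp-↭ (~⇒↭ p) (unique L)
  ; bounded  = All-resp-↭ (~⇒↭ p) (bounded L)
  ; covers   = ∈-resp-↭ (~⇒↭ p) ∘ covers L
  ; allowed  = allowed L ∘ Adj-resp-~ (~-sym p)
  ; required = Adj-resp-~ p ∘ required L
  }

-- Links at 0 are dropped along with 0; that they lead to its chosen neighbours is the separate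
-- condition `Forced`.
shift : Links → Links
shift []                    = []
shift ((suc x , suc y) ∷ S) = (x , y) ∷ shift S
shift ((zero  , _)     ∷ S) = shift S
shift ((suc _ , zero)  ∷ S) = shift S

∈-shift⁺ : ∀ {x y S} → (suc x , suc y) ∈ S → (x , y) ∈ shift S
∈-shift⁺                           (here refl) = here refl
∈-shift⁺ {S = (suc _ , suc _) ∷ S} (there p)   = there (∈-shift⁺ p)
∈-shift⁺ {S = (zero  , _)     ∷ S} (there p)   = ∈-shift⁺ p
∈-shift⁺ {S = (suc _ , zero)  ∷ S} (there p)   = ∈-shift⁺ p

∈-shift⁻ : ∀ {x y} S → (x , y) ∈ shift S → (suc x , suc y) ∈ S
∈-shift⁻ ((suc _ , suc _) ∷ S) (here refl) = here refl
∈-shift⁻ ((suc _ , suc _) ∷ S) (there p)   = there (∈-shift⁻ S p)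
∈-shift⁻ ((zero  , _)     ∷ S) p           = there (∈-shift⁻ S p)
∈-shift⁻ ((suc _ , zero)  ∷ S) p           = there (∈-shift⁻ S p)

contractLinks : Links → ℕ × ℕ → Links
contractLinks S c = c ∷ shift S

Same : ℕ × ℕ → ℕ × ℕ → Set
Same (p , q) (x , y) = (x ≡ p × y ≡ q) ⊎ (y ≡ p × x ≡ q)

Link-contract⁺ : ∀ {S c x y} → Link S (suc x) (suc y) → Link (contractLinks S c) x y
Link-contract⁺ = Sum.map (there ∘ ∈-shift⁺) (there ∘ ∈-shift⁺)

Link-contract⁻ : ∀ {S c x y} → Link (contractLinks S c) x y →
                 Same c (x , y) ⊎ Link S (suc x) (suc y)
Link-contract⁻     (inj₁ (here refl)) = inj₁ (inj₁ (refl , refl))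
Link-contract⁻ {S} (inj₁ (there p))   = inj₂ (inj₁ (∈-shift⁻ S p))
Link-contract⁻     (inj₂ (here refl)) = inj₁ (inj₂ (refl , refl))
Link-contract⁻ {S} (inj₂ (there p))   = inj₂ (inj₂ (∈-shift⁻ S p))

-- Deleting the entry 0

delete₀ : List ℕ → List ℕ
delete₀ []           = []
delete₀ (zero  ∷ xs) = delete₀ xs
delete₀ (suc x ∷ xs) = x ∷ delete₀ xs

delete₀-++ : ∀ xs ys → delete₀ (xs ++ ys) ≡ delete₀ xs ++ delete₀ ys
delete₀-++ []           ys = refl
delete₀-++ (zero  ∷ xs) ys = delete₀-++ xs ys
delete₀-++ (suc x ∷ xs) ys = cong (x ∷_) (delete₀-++ xs ys)

delete₀-map-suc : ∀ xs → delete₀ (map suc xs) ≡ xs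
delete₀-map-suc []       = refl
delete₀-map-suc (x ∷ xs) = cong (x ∷_) (delete₀-map-suc xs)

map-suc-delete₀ : ∀ xs → 0 ∉ xs → map suc (delete₀ xs) ≡ xs
map-suc-delete₀ []           0∉ = refl
map-suc-delete₀ (zero  ∷ xs) 0∉ = contradiction (here refl) 0∉
map-suc-delete₀ (suc x ∷ xs) 0∉ = cong (suc x ∷_) (map-suc-delete₀ xs (0∉ ∘ there))

delete₀-reverse : ∀ xs → delete₀ (reverse xs) ≡ reverse (delete₀ xs)
delete₀-reverse []       = refl
delete₀-reverse (x ∷ xs)
  rewrite unfold-reverse x xs | delete₀-++ (reverse xs) [ x ] | delete₀-reverse xs
  with x
... | zero  = ++-identityʳ _
... | suc x = sym (unfold-reverse x (delete₀ xs))

delete₀-≈ᵣ : ∀ {xs ys} → xs ≈ᵣ ys → delete₀ xs ≈ᵣ delete₀ ys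
delete₀-≈ᵣ (rotate xs ys)
  rewrite delete₀-++ xs ys | delete₀-++ ys xs = rotate (delete₀ xs) (delete₀ ys)

delete₀-~ : ∀ {xs ys} → xs ~ ys → delete₀ xs ~ delete₀ ys
delete₀-~           (rotation p)   = rotation (delete₀-≈ᵣ p)
delete₀-~ {ys = ys} (reflection p) = reflection (subst (_ ≈ᵣ_) (delete₀-reverse ys) (delete₀-≈ᵣ p))

map-suc-∷-∷ʳ : ∀ p m q → map suc (p ∷ m ∷ʳ q) ≡ suc p ∷ map suc m ∷ʳ suc q
map-suc-∷-∷ʳ p m q = cong (suc p ∷_) (map-++ suc m [ q ])

-- In a reading from `suc x` to `suc y`, deleting 0 leaves both ends in place.
Adj-delete₀ : ∀ {w x y} → Adj (0 ∷ map suc w) (suc x) (suc y) → Adj w x y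
Adj-delete₀ {w} {x} {y} (m , p) = delete₀ m ,
  subst (w ~_) (cong (x ∷_) (delete₀-++ m [ suc y ]))
    (subst (_~ x ∷ delete₀ (m ∷ʳ suc y)) (delete₀-map-suc w) (delete₀-~ p))

0∉map-suc : ∀ w → 0 ∉ map suc w
0∉map-suc w 0∈ with ∈-map⁻ suc 0∈
... | _ , _ , ()

-- The cycle `w` is read so that `q` and `p` meet across its ends; `X` puts 0 into that gap.
module Insert (p : ℕ) (m : List ℕ) (q : ℕ) where

  w X : List ℕ
  w = p ∷ m ∷ʳ q
  X = 0 ∷ map suc w

  X≡ : X ≡ 0 ∷ suc p ∷ map suc m ∷ʳ suc q
  X≡ = cong (0 ∷_) (map-suc-∷-∷ʳ p m q)

  Adj-0q : Adj X 0 (suc q)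
  Adj-0q = suc p ∷ map suc m , ~-reflexive X≡

  Adj-0p : Adj X 0 (suc p)
  Adj-0p = Consecutive⇒Adj (infix-of [] (map suc (m ∷ʳ q)))

  Adj-0⁻ : ∀ {x} → Adj X 0 x → x ≡ suc p ⊎ x ≡ suc q
  Adj-0⁻ {x} adj = Adj-head-inv (subst (0 ∉_) (map-suc-∷-∷ʳ p m q) (0∉map-suc w))
    (subst (λ xs → Adj xs 0 x) X≡ adj)

  Consecutive-suc : ∀ {x y} → Consecutive x y w → Adj X (suc x) (suc y)
  Consecutive-suc c = Consecutive⇒Adj (go c)
    where
    go : ∀ {x y us} → Consecutive x y us → Consecutive (suc x) (suc y) (0 ∷ map suc us)
    go {x} {y} (infix-of us vs) =
      subst (Consecutive (suc x) (suc y) ∘ (0 ∷_)) (sym (map-++ suc us (x ∷ y ∷ vs)))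
        (infix-of (0 ∷ map suc us) (map suc vs))

  -- Adjacencies inside the list `w` survive the insertion; only the one across the ends, between
  -- `q` and `p`, can be broken by 0.
  Adj-suc : ∀ {x y} → Adj w x y → Adj X (suc x) (suc y) ⊎ Same (p , q) (x , y)
  Adj-suc adj with Adj-cases adj
  ... | inj₁ (inj₁ c) = inj₁ (Consecutive-suc c)
  ... | inj₁ (inj₂ c) = inj₁ (Adj-sym (Consecutive-suc c))
  ... | inj₂ same     = inj₂ same

  -- Three entries provide an `h` next to `p` and different from `q`. The neighbours of `suc p` in
  -- `X` are then 0 and `suc h`.
  ¬Adj-pq : Unique w → 3 ≤ length w → ¬ Adj X (suc p) (suc q)
  ¬Adj-pq w! 3≤ adj = go m refl w! 3≤
    where
    go : ∀ m′ → m′ ≡ m → Unique (p ∷ m′ ∷ʳ q) → ¬ (3 ≤ length (p ∷ m′ ∷ʳ q))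
    go []       _    _              (s≤s (s≤s ()))
    go (h ∷ m′) refl (p∉ ∷ h∉ ∷ _) _
      with Adj-head-inv p∉tail (Adj-resp-~ (rotation (rotate [ 0 ] (map suc w))) adj)
      where
      p∉tail : suc p ∉ suc h ∷ map suc (m′ ∷ʳ q) ∷ʳ 0
      p∉tail p∈ with ∈-++⁻ (map suc (h ∷ m′ ∷ʳ q)) p∈
      ... | inj₂ (here ())
      ... | inj₁ p∈ with ∈-map⁻ suc p∈
      ...   | _ , p∈ , refl = All.lookup p∉ p∈ refl
    ... | inj₁ refl = All.lookup h∉ (∈-++⁺ʳ m′ (here refl)) refl
    ... | inj₂ ()

-- Contraction at the entry 0

-- The pair c = (p - 1 , q - 1) records the neighbours p < q of 0 by their values after deletion.
record LinkedVia (S : Links) (n : ℕ) (c : ℕ × ℕ) (xs : List ℕ) : Set where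
  field
    linked : Linked S (suc n) xs
    order  : proj₁ c < proj₂ c
    adj-p  : Adj xs 0 (suc (proj₁ c))
    adj-q  : Adj xs 0 (suc (proj₂ c))

open LinkedVia

-- A link at 0 is compulsory, so its other end has to be one of the two neighbours of 0.
Forced : ℕ × ℕ → ℕ × ℕ → Set
Forced (p , q) (x , y) = (x ≡ 0 → y ≡ suc p ⊎ y ≡ suc q) × (y ≡ 0 → x ≡ suc p ⊎ x ≡ suc q)

-- noChord: a link between both neighbours of 0 would close a triangle.
record Admissible (S : Links) (c : ℕ × ℕ) : Set where
  constructor admissible
  field
    order     : proj₁ c < proj₂ c
    forced    : All (Forced c) S
    allowed-p : Allowed S 0 (suc (proj₁ c))
    allowed-q : Allowed S 0 (suc (proj₂ c))
    noChord   : ¬ Link S (suc (proj₁ c)) (suc (proj₂ c))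

neighboursOf0 : ∀ {S n xs} → 2 ≤ n → Linked S (suc n) xs →
                ∃₂ λ p q → ∃ λ m → xs ~ 0 ∷ map suc (p ∷ m ∷ʳ q)
neighboursOf0 2≤n L with us , xs~ ← ∈⇒~∷ (covers L z<s)
  with L′ ← Linked-resp-~ xs~ L
  with us≡ ← map-suc-delete₀ us (Unique[x∷xs]⇒x∉xs (unique L′))
  with p , m , q , eq ← ∷-∷ʳ-view (delete₀ us) (subst (2 ≤_)
         (sym (trans (sym (length-map suc (delete₀ us)))
           (trans (cong length us≡) (suc-injective (size L′))))) 2≤n)
  = p , q , m , subst (λ us → _ ~ 0 ∷ us) (trans (sym us≡) (cong (map suc) eq)) xs~

module _ {S : Links} {n : ℕ} (3≤n : 3 ≤ n) where

  -- Abstract because the with-abstractions over it below would otherwise unfold its proof.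
  abstract
    LinkedVia⇒~ : ∀ {p q xs} → LinkedVia S n (p , q) xs →
                  ∃ λ m → xs ~ 0 ∷ map suc (p ∷ m ∷ʳ q)
    LinkedVia⇒~ {p} {q} V with neighboursOf0 (≤-trans (n≤1+n 2) 3≤n) (linked V)
    ... | p′ , q′ , m , xs~
      with Insert.Adj-0⁻ p′ m q′ (Adj-resp-~ xs~ (adj-p V))
         | Insert.Adj-0⁻ p′ m q′ (Adj-resp-~ xs~ (adj-q V))
    ... | inj₁ refl | inj₂ refl = m , xs~
    ... | inj₁ refl | inj₁ refl = contradiction (order V) (<-irrefl refl)
    ... | inj₂ refl | inj₂ refl = contradiction (order V) (<-irrefl refl)
    -- The neighbours appear in the opposite order; reversing everything after 0 exchanges them.
    ... | inj₂ refl | inj₁ refl = reverse m , ~-trans xs~ (~-trans (~-reverse-tail 0 _)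
            (~-reflexive (cong (0 ∷_) (trans (sym (reverse-map suc (p′ ∷ m ∷ʳ q′)))
              (cong (map suc) (reverse-∷-∷ʳ p′ m q′))))))

  private
    length-w : ∀ {p m q} → Linked S (suc n) (0 ∷ map suc (p ∷ m ∷ʳ q)) → length (p ∷ m ∷ʳ q) ≡ n
    length-w {p} {m} {q} L = trans (sym (length-map suc (p ∷ m ∷ʳ q))) (suc-injective (size L))

    unique-w : ∀ {w} → Linked S (suc n) (0 ∷ map suc w) → Unique w
    unique-w L with _ ∷ u ← unique L = Unique-map⁻ u

  -- Necessity of the conditions; `expand` shows that they suffice. A chord would force the
  -- adjacency that `¬Adj-pq` excludes.
  LinkedVia⇒Admissible : ∀ {c xs} → LinkedVia S n c xs → Admissible S c
  LinkedVia⇒Admissible {p , q} V with m , xs~ ← LinkedVia⇒~ V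
    = record
    { order     = order V
    ; forced    = All.tabulate λ {(x , y)} xy∈S →
        (λ { refl → Adj-0⁻ (required L (inj₁ xy∈S)) }) ,
        (λ { refl → Adj-0⁻ (required L (inj₂ xy∈S)) })
    ; allowed-p = allowed L Adj-0p
    ; allowed-q = allowed L Adj-0q
    ; noChord   = ¬Adj-pq (unique-w L) (subst (3 ≤_) (sym (length-w L)) 3≤n) ∘ required L
    }
    where
    open Insert p m q
    L = Linked-resp-~ xs~ (linked V)

  -- An adjacency of the shorter cycle either comes from the longer one, where lowering both entries
  -- keeps their difference, or is the new pair, which is a link by decree.
  contract : ∀ {c xs} → LinkedVia S n c xs → Linked (contractLinks S c) n (delete₀ xs)
  contract {p , q} {xs} V with m , xs~ ← LinkedVia⇒~ V
    = Linked-resp-~ (~-sym (subst (delete₀ xs ~_) (delete₀-map-suc (p ∷ m ∷ʳ q))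
        (delete₀-~ {xs = xs} xs~)))
    (record
    { size     = length-w L
    ; unique   = unique-w L
    ; bounded  = All.map s<s⁻¹ (All.map⁻ (All.tail (bounded L)))
    ; covers   = λ i<n → covered (covers L (s<s i<n))
    ; allowed  = λ adj → [ Sum.map₁ (Link-contract⁺ {S}) ∘ allowed L , inj₁ ∘ chosen ]′ (Adj-suc adj)
    ; required = λ {x} {y} l → [ same⇒Adj , Adj-delete₀ ∘ required L ]′ (Link-contract⁻ {S} l)
    })
    where
    open Insert p m q
    L = Linked-resp-~ xs~ (linked V)
    covered : ∀ {i} → suc i ∈ X → i ∈ w
    covered (there i∈) with _ , i∈w , refl ← ∈-map⁻ suc i∈ = i∈w
    chosen : ∀ {x y} → Same (p , q) (x , y) → Link (contractLinks S (p , q)) x y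
    chosen (inj₁ (refl , refl)) = inj₁ (here refl)
    chosen (inj₂ (refl , refl)) = inj₂ (here refl)
    same⇒Adj : ∀ {x y} → Same (p , q) (x , y) → Adj w x y
    same⇒Adj (inj₁ (refl , refl)) = Adj-∷-∷ʳ p m q
    same⇒Adj (inj₂ (refl , refl)) = Adj-sym (Adj-∷-∷ʳ p m q)

  -- The link `c` guarantees a reading of `ws` from `p` to `q`, and 0 is inserted between its ends.
  expand : ∀ {c} → Admissible S c → ∀ {ws} → Linked (contractLinks S c) n ws →
           ∃ λ xs → LinkedVia S n c xs × delete₀ xs ~ ws
  expand {p , q} A {ws} L₀ with m , ws~ ← required L₀ (inj₁ (here refl)) =
    X , record { linked = linkedX ; order = Admissible.order A ; adj-p = Adj-0p ; adj-q = Adj-0q }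
      , subst (_~ ws) (sym (delete₀-map-suc w)) (~-sym ws~)
    where
    open Insert p m q
    open Admissible A using (forced; allowed-p; allowed-q; noChord)
    L = Linked-resp-~ ws~ L₀

    noTriangle : ¬ Adj X (suc p) (suc q)
    noTriangle = ¬Adj-pq (unique L) (subst (3 ≤_) (sym (size L)) 3≤n)

    noSame : ∀ {x y} → Same (p , q) (x , y) → ¬ Adj X (suc x) (suc y)
    noSame (inj₁ (refl , refl)) = noTriangle
    noSame (inj₂ (refl , refl)) = noTriangle ∘ Adj-sym

    noLink : ∀ {x y} → Same (p , q) (x , y) → ¬ Link S (suc x) (suc y)
    noLink (inj₁ (refl , refl)) = noChord
    noLink (inj₂ (refl , refl)) = noChord ∘ Link-sym {S}

    allowed₀ : ∀ {x} → Adj X 0 x → Allowed S 0 x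
    allowed₀ adj with Adj-0⁻ adj
    ... | inj₁ refl = allowed-p
    ... | inj₂ refl = allowed-q

    adj₀ : ∀ {x} → x ≡ suc p ⊎ x ≡ suc q → Adj X 0 x
    adj₀ (inj₁ refl) = Adj-0p
    adj₀ (inj₂ refl) = Adj-0q

    allowedX : ∀ x y → Adj X x y → Allowed S x y
    allowedX zero    y       adj = allowed₀ adj
    allowedX (suc x) zero    adj = Allowed-sym {S} 0 (suc x) (allowed₀ (Adj-sym adj))
    allowedX (suc x) (suc y) adj with allowed L (Adj-delete₀ adj)
    ... | inj₂ near = inj₂ near
    ... | inj₁ link with Link-contract⁻ {S} link
    -- Only the pair `c` could be allowed by the new decree alone, and the inserted 0 separates it.
    ...   | inj₁ same  = contradiction adj (noSame same)
    ...   | inj₂ link′ = inj₁ link′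

    required₀ : ∀ {x} → Link S 0 x → Adj X 0 x
    required₀ (inj₁ l) = adj₀ (proj₁ (All.lookup forced l) refl)
    required₀ (inj₂ l) = adj₀ (proj₂ (All.lookup forced l) refl)

    requiredX : ∀ x y → Link S x y → Adj X x y
    requiredX zero    y       l = required₀ l
    requiredX (suc x) zero    l = Adj-sym (required₀ (Link-sym {S} l))
    requiredX (suc x) (suc y) l with Adj-suc (required L (Link-contract⁺ {S} l))
    ... | inj₁ adj  = adj
    -- The insertion destroys the adjacency of `p` and `q`, but by `noChord` no link of `S` asks for
    -- it.
    ... | inj₂ same = contradiction l (noLink same)

    coversX : ∀ {i} → i < suc n → i ∈ X
    coversX {zero}  _         = here refl
    coversX {suc i} (s≤s i<n) = there (∈-map⁺ suc (covers L i<n))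

    linkedX : Linked S (suc n) X
    linkedX = record
      { size     = cong suc (trans (length-map suc w) (size L))
      ; unique   = All.tabulate (λ { x∈ refl → 0∉map-suc w x∈ }) ∷ Unique-map⁺ suc-injective (unique L)
      ; bounded  = z<s ∷ All.map⁺ (All.map s<s (bounded L))
      ; covers   = coversX
      ; allowed  = allowedX _ _
      ; required = requiredX _ _
      }

  -- After deletion both cycles are read from `p` to `q`, so what follows `p` agrees or is reversed.
  -- A reversal would put `q` right after `p`, impossible for three or more distinct entries.
  delete₀-injective : ∀ {c xs ys} → LinkedVia S n c xs → LinkedVia S n c ys →
                      delete₀ xs ~ delete₀ ys → xs ~ ys
  delete₀-injective {p , q} {xs} {ys} V V′ d
    with m , xs~ ← LinkedVia⇒~ V | m′ , ys~ ← LinkedVia⇒~ V′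
    = ~-trans xs~ (~-trans (~-reflexive (cong (λ t → 0 ∷ map suc (p ∷ t))
        (equal m (unique-w L) (subst (3 ≤_) (sym (length-w L)) 3≤n) w~w′))) (~-sym ys~))
    where
    L = Linked-resp-~ xs~ (linked V)
    w~w′ : p ∷ m ∷ʳ q ~ p ∷ m′ ∷ʳ q
    w~w′ = ~-trans (subst (_~ delete₀ xs) (delete₀-map-suc (p ∷ m ∷ʳ q))
        (~-sym (delete₀-~ {xs = xs} xs~)))
      (~-trans d (subst (delete₀ ys ~_) (delete₀-map-suc (p ∷ m′ ∷ʳ q)) (delete₀-~ {xs = ys} ys~)))
    equal : ∀ m → Unique (p ∷ m ∷ʳ q) → 3 ≤ length (p ∷ m ∷ʳ q) →
            p ∷ m ∷ʳ q ~ p ∷ m′ ∷ʳ q → m ∷ʳ q ≡ m′ ∷ʳ q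
    equal m u 3≤ s with ~-cancel (Unique[x∷xs]⇒x∉xs u) s
    ... | inj₁ e = e
    equal []      u (s≤s (s≤s ())) s | inj₂ e
    equal (h ∷ m) (_ ∷ h∉ ∷ _) _ s | inj₂ e
      with refl ← ∷-injectiveˡ (trans e (reverse-++ m′ [ q ])) =
        contradiction refl (All.lookup h∉ (∈-++⁺ʳ m (here refl)))

  -- Equivalent lists give 0 the same two neighbours, and `order` fixes which comes first.
  LinkedVia-disjoint : ∀ {c c′ xs ys} → LinkedVia S n c xs → LinkedVia S n c′ ys → xs ~ ys → c ≡ c′
  LinkedVia-disjoint {p , q} {p′ , q′} V V′ xs~ys with m , xs~ ← LinkedVia⇒~ V
    with Insert.Adj-0⁻ p m q (Adj-resp-~ (~-trans (~-sym xs~ys) xs~) (adj-p V′))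
       | Insert.Adj-0⁻ p m q (Adj-resp-~ (~-trans (~-sym xs~ys) xs~) (adj-q V′))
  ... | inj₁ refl | inj₂ refl = refl
  ... | inj₁ refl | inj₁ refl = contradiction (order V′) (<-irrefl refl)
  ... | inj₂ refl | inj₂ refl = contradiction (order V′) (<-irrefl refl)
  ... | inj₂ refl | inj₁ refl = contradiction (order V′) (<⇒≯ (order V))

-- Counting by contraction

link? : ∀ S x y → Dec (Link S x y)
link? S x y = (x , y) ∈ₚ? S ⊎-dec (y , x) ∈ₚ? S
  where
  _∈ₚ?_ = _∈?_ (≡-dec _≟_ _≟_)

allowed? : ∀ S x y → Dec (Allowed S x y)
allowed? S x y = link? S x y ⊎-dec (∣ x - y ∣ ≟ 1 ⊎-dec ∣ x - y ∣ ≟ 4)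

forced? : ∀ c l → Dec (Forced c l)
forced? (p , q) (x , y) =
  (x ≟ 0 →-dec (y ≟ suc p ⊎-dec y ≟ suc q)) ×-dec (y ≟ 0 →-dec (x ≟ suc p ⊎-dec x ≟ suc q))

admissible? : ∀ S c → Dec (Admissible S c)
admissible? S c@(p , q) = map′
  (λ (o , f , ap , aq , n) → admissible o f ap aq n)
  (λ (admissible o f ap aq n) → o , f , ap , aq , n)
  (p <? q ×-dec All.all? (forced? c) S ×-dec allowed? S 0 (suc p) ×-dec
   allowed? S 0 (suc q) ×-dec ¬? (link? S (suc p) (suc q)))

InTriangle : ℕ × ℕ → Set
InTriangle (x , y) = x < 3 × y < 3 × x ≢ y

-- On three entries all pairs are adjacent. The pair 0, 2 is at distance 2 and needs a link; any
-- link between distinct entries below 3 is satisfied.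
Final : Links → Set
Final S = Link S 0 2 × All InTriangle S

final? : ∀ S → Dec (Final S)
final? S = link? S 0 2 ×-dec All.all? (λ (x , y) → x <? 3 ×-dec y <? 3 ×-dec ¬? (x ≟ y)) S

-- For bounded links a neighbour of 0 is 1, 4 or an entry linked to 0, so its lowered value is below
-- 4.
choices : List (ℕ × ℕ)
choices = cartesianProduct (upTo 4) (upTo 4)

-- Indexed by n - 3, since the smallest necklaces have length 3.
count : ℕ → Links → ℕ
count zero    S = if does (final? S) then 1 else 0
count (suc k) S =
  sum (map (λ c → if does (admissible? S c) then count k (contractLinks S c) else 0) choices)

Bounded : Links → Set
Bounded = All λ (x , y) → x < 4 × y < 4

Allowed-0-bound : ∀ {S x} → Bounded S → Allowed S 0 (suc x) → x < 4
Allowed-0-bound B (inj₁ (inj₁ l)) = <⇒≤ (proj₂ (All.lookup B l))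
Allowed-0-bound B (inj₁ (inj₂ l)) = <⇒≤ (proj₁ (All.lookup B l))
Allowed-0-bound B (inj₂ (inj₁ refl)) = s≤s z≤n
Allowed-0-bound B (inj₂ (inj₂ refl)) = ≤-refl

shift-bounded : ∀ {S} → Bounded S → Bounded (shift S)
shift-bounded []                                        = []
shift-bounded {(suc _ , suc _) ∷ _} ((x<4 , y<4) ∷ B) = (<⇒≤ x<4 , <⇒≤ y<4) ∷ shift-bounded B
shift-bounded {(zero  , _)     ∷ _} (_ ∷ B)           = shift-bounded B
shift-bounded {(suc _ , zero)  ∷ _} (_ ∷ B)           = shift-bounded B

-- The bound 4 is invariant: the new pair consists of lowered neighbours of 0, and the remaining
-- links move down.
contract-bounded : ∀ {S c} → Bounded S → Admissible S c → Bounded (contractLinks S c)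
contract-bounded {S} B A =
  (Allowed-0-bound {S} B (Admissible.allowed-p A) , Allowed-0-bound {S} B (Admissible.allowed-q A))
  ∷ shift-bounded B

-- The base case of three entries

triangle : List ℕ
triangle = 0 ∷ 1 ∷ 2 ∷ []

Linked-3⇒triangle : ∀ {S xs} → Linked S 3 xs → xs ~ triangle
Linked-3⇒triangle L with neighboursOf0 (s≤s (s≤s z≤n)) L
... | p , q , m , xs~ with Linked-resp-~ xs~ L
...   | L′ = go p m q (size L′) (bounded L′) (unique L′) xs~
  where
  go : ∀ p m q → length (0 ∷ map suc (p ∷ m ∷ʳ q)) ≡ 3 →
       All (_< 3) (0 ∷ map suc (p ∷ m ∷ʳ q)) → Unique (0 ∷ map suc (p ∷ m ∷ʳ q)) →
       ∀ {xs} → xs ~ 0 ∷ map suc (p ∷ m ∷ʳ q) → xs ~ triangle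
  go 0 [] 1 _ _ _ s = s
  -- The order 0, 2, 1 is the mirror image of the triangle.
  go 1 [] 0 _ _ _ s = ~-trans s (~-reverse-tail 0 (2 ∷ 1 ∷ []))
  go 0 [] 0 _ _ (_ ∷ (d ∷ []) ∷ _) s = contradiction refl d
  go 1 [] 1 _ _ (_ ∷ (d ∷ []) ∷ _) s = contradiction refl d
  go (suc (suc p)) [] q _ (_ ∷ s≤s (s≤s (s≤s ())) ∷ _) _ s
  go p [] (suc (suc q)) _ (_ ∷ _ ∷ s≤s (s≤s (s≤s ())) ∷ _) _ s
  go p (_ ∷ []) q () _ _ s
  go p (_ ∷ _ ∷ _) q () _ _ s

Adj⇒∈ : ∀ {A : Set} {xs : List A} {x y} → Adj xs x y → x ∈ xs
Adj⇒∈ (m , p) = ∈-resp-↭ (↭-sym (~⇒↭ p)) (here refl)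

Adj⇒≢ : ∀ {A : Set} {xs : List A} {x y} → Unique xs → Adj xs x y → x ≢ y
Adj⇒≢ u (m , p) refl with x∉ ∷ _ ← Unique-resp-↭ (~⇒↭ p) u =
  All.lookup x∉ (∈-++⁺ʳ m (here refl)) refl

Adj-triangle : ∀ {x y} → x < 3 → y < 3 → x ≢ y → Adj triangle x y
Adj-triangle {0} {1} _ _ _ = Consecutive⇒Adj (infix-of [] (2 ∷ []))
Adj-triangle {1} {2} _ _ _ = Consecutive⇒Adj (infix-of (0 ∷ []) [])
Adj-triangle {0} {2} _ _ _ = Adj-∷-∷ʳ 0 (1 ∷ []) 2
Adj-triangle {1} {0} _ _ _ = Adj-sym (Consecutive⇒Adj (infix-of [] (2 ∷ [])))
Adj-triangle {2} {1} _ _ _ = Adj-sym (Consecutive⇒Adj (infix-of (0 ∷ []) []))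
Adj-triangle {2} {0} _ _ _ = Adj-sym (Adj-∷-∷ʳ 0 (1 ∷ []) 2)
Adj-triangle {0} {0} _ _ d = contradiction refl d
Adj-triangle {1} {1} _ _ d = contradiction refl d
Adj-triangle {2} {2} _ _ d = contradiction refl d
Adj-triangle {suc (suc (suc _))} (s≤s (s≤s (s≤s ())))
Adj-triangle {_} {suc (suc (suc _))} _ (s≤s (s≤s (s≤s ())))

Linked-3⇒Final : ∀ {S xs} → Linked S 3 xs → Final S
Linked-3⇒Final {S} L₀ with L ← Linked-resp-~ (Linked-3⇒triangle L₀) L₀ =
  link , All.tabulate λ xy∈S → let adj = required L (inj₁ xy∈S) in
    All.lookup (bounded L) (Adj⇒∈ adj) , All.lookup (bounded L) (Adj⇒∈ (Adj-sym adj)) ,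
    Adj⇒≢ (unique L) adj
  where
  link : Link S 0 2
  link with allowed (Linked-resp-~ (Linked-3⇒triangle L₀) L₀) (Adj-∷-∷ʳ 0 (1 ∷ []) 2)
  ... | inj₁ l = l
  ... | inj₂ (inj₁ ())
  ... | inj₂ (inj₂ ())

Final⇒Linked-3 : ∀ {S} → Final S → Linked S 3 triangle
Final⇒Linked-3 {S} (l02 , tri) = record
  { size     = refl
  ; unique   = upTo⁺ 3
  ; bounded  = bnd
  ; covers   = ∈-upTo⁺
  ; allowed  = λ adj → allowed′ (All.lookup bnd (Adj⇒∈ adj)) (All.lookup bnd (Adj⇒∈ (Adj-sym adj)))
                                (Adj⇒≢ (upTo⁺ 3) adj)
  ; required = λ
      { (inj₁ l) → let (x<3 , y<3 , x≢y) = All.lookup tri l in Adj-triangle x<3 y<3 x≢y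
      ; (inj₂ l) → let (x<3 , y<3 , x≢y) = All.lookup tri l in Adj-sym (Adj-triangle x<3 y<3 x≢y)
      }
  }
  where
  bnd : All (_< 3) triangle
  bnd = z<s ∷ s<s z<s ∷ s<s (s<s z<s) ∷ []
  allowed′ : ∀ {x y} → x < 3 → y < 3 → x ≢ y → Allowed S x y
  allowed′ {0} {1} _ _ _ = inj₂ (inj₁ refl)
  allowed′ {1} {2} _ _ _ = inj₂ (inj₁ refl)
  allowed′ {0} {2} _ _ _ = inj₁ l02
  allowed′ {1} {0} _ _ _ = inj₂ (inj₁ refl)
  allowed′ {2} {1} _ _ _ = inj₂ (inj₁ refl)
  allowed′ {2} {0} _ _ _ = inj₁ (Link-sym {S} l02)
  allowed′ {0} {0} _ _ d = contradiction refl d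
  allowed′ {1} {1} _ _ d = contradiction refl d
  allowed′ {2} {2} _ _ d = contradiction refl d
  allowed′ {suc (suc (suc _))} (s≤s (s≤s (s≤s ())))
  allowed′ {_} {suc (suc (suc _))} _ (s≤s (s≤s (s≤s ())))

-- Induction for all bounded `S` at once, as contraction changes `S`. The parts given by the
-- neighbours of 0 are disjoint, an inadmissible pair has an empty part, and `delete₀` carries an
-- admissible one to the contracted links.
count-enumerates : ∀ k {S} → Bounded S → Enumerates _~_ (Linked S (3 + k)) (count k S)
count-enumerates zero {S} B = Enumerates-if (final? S) Linked-3⇒Final λ F → record
  { reps     = triangle ∷ []
  ; card     = refl
  ; sound    = Final⇒Linked-3 F ∷ []
  ; apart    = [] ∷ []
  ; complete = here ∘ Linked-3⇒triangle
  }
count-enumerates (suc k) {S} B =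
  Enumerates-⇔ via⇒linked linked⇒via
    (Enumerates-⋃ (LinkedVia-disjoint 3≤) choice (cartesianProduct⁺ (upTo⁺ 4) (upTo⁺ 4)))
  where
  3≤ : 3 ≤ 3 + k
  3≤ = s≤s (s≤s (s≤s z≤n))

  choice : ∀ c → Enumerates _~_ (LinkedVia S (3 + k) c)
                   (if does (admissible? S c) then count k (contractLinks S c) else 0)
  choice c = Enumerates-if (admissible? S c) (LinkedVia⇒Admissible 3≤) λ A →
    Enumerates-pullback ~-isEquivalence delete₀ (contract 3≤) (λ _ _ → delete₀-~)
      (delete₀-injective 3≤) (expand 3≤ A) (count-enumerates k (contract-bounded B A))

  via⇒linked : ∀ {xs} → Any (λ c → LinkedVia S (3 + k) c xs) choices → Linked S (4 + k) xs
  via⇒linked a = linked (proj₂ (Any.satisfied a))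

  choose : ∀ {p q xs} → LinkedVia S (3 + k) (p , q) xs → Any (λ c → LinkedVia S (3 + k) c xs) choices
  choose V = lose (∈-cartesianProduct⁺
    (∈-upTo⁺ (Allowed-0-bound {S} B (allowed (linked V) (adj-p V))))
    (∈-upTo⁺ (Allowed-0-bound {S} B (allowed (linked V) (adj-q V))))) V

  linked⇒via : ∀ {xs} → Linked S (4 + k) xs → Any (λ c → LinkedVia S (3 + k) c xs) choices
  linked⇒via {xs} L with neighboursOf0 (s≤s (s≤s z≤n)) L
  ... | p , q , m , xs~ with <-cmp p q
  -- The reading fixes no order between the neighbours, so they are sorted here.
  ...   | tri< p<q _ _ = choose (record { linked = L ; order = p<q
          ; adj-p = Adj-resp-~ (~-sym xs~) (Insert.Adj-0p p m q)
          ; adj-q = Adj-resp-~ (~-sym xs~) (Insert.Adj-0q p m q) })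
  ...   | tri> _ _ q<p = choose (record { linked = L ; order = q<p
          ; adj-p = Adj-resp-~ (~-sym xs~) (Insert.Adj-0q p m q)
          ; adj-q = Adj-resp-~ (~-sym xs~) (Insert.Adj-0p p m q) })
  ...   | tri≈ _ refl _ with _ ∷ p∉ ∷ _ ← unique (Linked-resp-~ xs~ L) =
          contradiction refl (All.lookup p∉ (∈-map⁺ suc (∈-++⁺ʳ m (here refl))))

-- The linear system for the counts

count-∅ count-02 count-23 : ℕ → ℕ
count-∅ k = count k []
count-02 k = count k ((0 , 2) ∷ [])
count-23 k = count k ((2 , 3) ∷ [])

private
  -- Inadmissible choices contribute zeros; those at the end of a sum leave a `+ 0` to remove.
  +0 : ∀ {m n} → m ≡ n → m + 0 ≡ n
  +0 = trans (+-identityʳ _)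

-- With no other link, 0 can only lie between 1 and 4, so it is next to 1 anyway; on three entries
-- both counts are 0.
count-01 : ∀ k → count k ((0 , 1) ∷ []) ≡ count-∅ k
count-01 zero    = refl
count-01 (suc k) = refl

-- First 0 lies between 1 and 4, which leaves {03}. Then 3 is a forced neighbour of 0 and the other
-- is 1 or 4, which leaves {02} or {23}.
count-∅-step : ∀ k → count-∅ (2 + k) ≡ count-02 k + count-23 k
count-∅-step k = +0 (cong (count-02 k +_) (+0 refl))

-- Besides 2, the entry 0 has the neighbour 1 or 4. The first leaves {01}, which counts as no link;
-- the second starts the chain {13}, {03, 02}, {12}, {03, 01}, {02} without further choice.
count-02-step : ∀ k → count-02 (5 + k) ≡ count-∅ (4 + k) + count-02 k
count-02-step k = cong (count-∅ (4 + k) +_) (+0 (+0 (+0 (+0 (+0 refl)))))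

-- From {23} the only move leads to {03, 12}, which branches into {02, 01} and {23, 01}. The first
-- leads to {01}; the second leads to {03, 12}, just as {23} does.
count-23-step : ∀ k → count-23 (3 + k) ≡ count-∅ k + count-23 (1 + k)
count-23-step k = +0 (cong₂ _+_ (+0 (count-01 k)) (+0 refl))

-- Positions in a list

data At {A : Set} : List A → ℕ → A → Set where
  here  : ∀ {x xs} → At (x ∷ xs) 0 x
  there : ∀ {x y xs i} → At xs i x → At (y ∷ xs) (suc i) x

module _ {A : Set} where

  At-functional : ∀ {xs : List A} {i x y} → At xs i x → At xs i y → x ≡ y
  At-functional here      here      = refl
  At-functional (there p) (there q) = At-functional p q

  At-< : ∀ {xs : List A} {i x} → At xs i x → i < length xs
  At-< here      = z<s
  At-< (there p) = s<s (At-< p)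

  At-total : ∀ {xs : List A} {i} → i < length xs → ∃ λ x → At xs i x
  At-total {x ∷ xs} {zero}  _ = x , here
  At-total {x ∷ xs} {suc i} (s≤s i<) with y , p ← At-total i< = y , there p

  At-++ˡ : ∀ {xs ys : List A} {i x} → At xs i x → At (xs ++ ys) i x
  At-++ˡ here      = here
  At-++ˡ (there p) = there (At-++ˡ p)

  At-++ʳ : ∀ (xs : List A) {ys i x} → At ys i x → At (xs ++ ys) (length xs + i) x
  At-++ʳ []       p = p
  At-++ʳ (_ ∷ xs) p = there (At-++ʳ xs p)

  At-++⁻ : ∀ (xs : List A) {ys i x} → At (xs ++ ys) i x →
           At xs i x ⊎ ∃ λ j → i ≡ length xs + j × At ys j x
  At-++⁻ []       p    = inj₂ (_ , refl , p)
  At-++⁻ (_ ∷ xs) here = inj₁ here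
  At-++⁻ (_ ∷ xs) (there p) with At-++⁻ xs p
  ... | inj₁ q               = inj₁ (there q)
  ... | inj₂ (j , refl , q) = inj₂ (j , refl , q)

  At-reverse : ∀ {xs : List A} {i x} → At xs i x → At (reverse xs) (length xs ∸ suc i) x
  At-reverse {x ∷ xs} here rewrite unfold-reverse x xs =
    subst (λ i → At (reverse xs ∷ʳ x) i x)
      (trans (+-identityʳ (length (reverse xs))) (length-reverse xs)) (At-++ʳ (reverse xs) here)
  At-reverse {y ∷ xs} (there p) rewrite unfold-reverse y xs = At-++ˡ (At-reverse p)

  At-extensional : ∀ {xs ys : List A} → length xs ≡ length ys →
                   (∀ {i x} → At xs i x → At ys i x) → xs ≡ ys
  At-extensional {[]}     {[]}     _  _ = refl
  At-extensional {x ∷ xs} {y ∷ ys} eq f with f here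
  ... | here = cong (x ∷_) (At-extensional (suc-injective eq) (λ p → tail (f (there p))))
    where
    tail : ∀ {i z} → At (x ∷ ys) (suc i) z → At ys i z
    tail (there p) = p

  At⇒∈ : ∀ {xs : List A} {i x} → At xs i x → x ∈ xs
  At⇒∈ here      = here refl
  At⇒∈ (there p) = there (At⇒∈ p)

  ∈⇒At : ∀ {xs : List A} {x} → x ∈ xs → ∃ λ i → At xs i x
  ∈⇒At (here refl) = 0 , here
  ∈⇒At (there p) with i , q ← ∈⇒At p = suc i , there q

  At-injective⇒Unique : ∀ {xs : List A} → (∀ {i j x} → At xs i x → At xs j x → i ≡ j) → Unique xs
  At-injective⇒Unique {[]}     inj = []
  At-injective⇒Unique {x ∷ xs} inj =
    All.tabulate (λ { y∈ refl → x∉ y∈ }) ∷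
    At-injective⇒Unique (λ p q → suc-injective (inj (there p) (there q)))
    where
    x∉ : ¬ (x ∈ xs)
    x∉ x∈ with inj here (there (proj₂ (∈⇒At x∈)))
    ... | ()

  Unique⇒At-injective : ∀ {xs : List A} {i j x} → Unique xs → At xs i x → At xs j x → i ≡ j
  Unique⇒At-injective u        here      here      = refl
  Unique⇒At-injective (x∉ ∷ _) here      (there q) = contradiction refl (All.lookup x∉ (At⇒∈ q))
  Unique⇒At-injective (x∉ ∷ _) (there p) here      = contradiction refl (All.lookup x∉ (At⇒∈ p))
  Unique⇒At-injective (_ ∷ u)  (there p) (there q) = cong suc (Unique⇒At-injective u p q)

  At-consecutive : ∀ {xs : List A} {i x y} → At xs i x → At xs (suc i) y → Consecutive x y xs
  At-consecutive here (there here) = infix-of [] _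
  At-consecutive (there p) (there q) with At-consecutive p q
  ... | infix-of us vs = infix-of (_ ∷ us) vs

  Consecutive⇒At : ∀ {xs : List A} {x y} → Consecutive x y xs → ∃ λ i → At xs i x × At xs (suc i) y
  Consecutive⇒At {x = x} {y} (infix-of us vs) = length us
    , subst (λ i → At (us ++ x ∷ y ∷ vs) i x) (+-identityʳ _) (At-++ʳ us here)
    , subst (λ i → At (us ++ x ∷ y ∷ vs) i y) (+-comm (length us) 1) (At-++ʳ us (there here))

  -- Entries of `ys` move right by `length xs` without passing the end; entries of `xs` pass it
  -- exactly once.
  At-rotate : ∀ (xs ys : List A) {m i x} → length (xs ++ ys) ≡ suc m →
              At (ys ++ xs) i x → At (xs ++ ys) ((i + length xs) % suc m) x
  At-rotate xs ys {m} {i} {x} len p with At-++⁻ ys p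
  ... | inj₁ q = subst (λ j → At (xs ++ ys) j x)
        (sym (trans (m<n⇒m%n≡m small) (+-comm i (length xs))))
        (At-++ʳ xs q)
    where
    small : i + length xs < suc m
    small = subst (i + length xs <_)
              (trans (+-comm (length ys) (length xs)) (trans (sym (length-++ xs)) len))
              (+-monoˡ-< (length xs) (At-< q))
  ... | inj₂ (j , refl , q) = subst (λ j → At (xs ++ ys) j x) (sym reduce) (At-++ˡ q)
    where
    n≡ : length ys + length xs ≡ suc m
    n≡ = trans (+-comm (length ys) (length xs)) (trans (sym (length-++ xs)) len)
    rearrange : length ys + j + length xs ≡ j + suc m
    rearrange = trans (cong (_+ length xs) (+-comm (length ys) j))
      (trans (+-assoc j (length ys) (length xs)) (cong (j +_) n≡))
    j<n : j < suc m
    j<n = ≤-trans (At-< q) (subst (length xs ≤_) n≡ (m≤n+m (length xs) (length ys)))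
    reduce : (length ys + j + length xs) % suc m ≡ j
    reduce = trans (cong (_% suc m) rearrange) (trans ([m+n]%n≡m%n j (suc m)) (m<n⇒m%n≡m j<n))

-- Arrangements as lists of numbers

entries : ∀ {n k} → Vec (Fin n) k → List ℕ
entries []      = []
entries (x ∷ v) = toℕ x ∷ entries v

length-entries : ∀ {n k} (v : Vec (Fin n) k) → length (entries v) ≡ k
length-entries []      = refl
length-entries (x ∷ v) = cong suc (length-entries v)

At-entries : ∀ {n k} (v : Vec (Fin n) k) i → At (entries v) (toℕ i) (toℕ (lookup v i))
At-entries (x ∷ v) Fin.zero    = here
At-entries (x ∷ v) (Fin.suc i) = there (At-entries v i)

At-entries⁻ : ∀ {n k} (v : Vec (Fin n) k) {i x} → At (entries v) i x →
              ∃ λ j → i ≡ toℕ j × x ≡ toℕ (lookup v j)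
At-entries⁻ (y ∷ v) here = Fin.zero , refl , refl
At-entries⁻ (y ∷ v) (there p) with j , refl , eq ← At-entries⁻ v p = Fin.suc j , refl , eq

entries-surjective : ∀ {n} k xs → length xs ≡ k → All (_< n) xs →
                     ∃ λ (v : Vec (Fin n) k) → entries v ≡ xs
entries-surjective zero    []       _  []          = [] , refl
entries-surjective (suc k) (x ∷ xs) eq (x<n ∷ <n)
  with v , refl ← entries-surjective k xs (suc-injective eq) <n
  = fromℕ< x<n ∷ v , cong (_∷ entries v) (toℕ-fromℕ< x<n)

toℕ-⊕ : ∀ {m} (i : Fin (suc m)) k → toℕ (i ⊕ k) ≡ (toℕ i + k) % suc m
toℕ-⊕ {m} i k = toℕ-fromℕ< (m%n<n (toℕ i + k) (suc m))

module _ {m : ℕ} where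

  private variable
    v w : Arrangement (suc m)

  reverseᵛ : Arrangement (suc m) → Arrangement (suc m)
  reverseᵛ w = tabulate (lookup w ∘ opposite)

  lookup-reverseᵛ : ∀ w i → lookup (reverseᵛ w) i ≡ lookup w (opposite i)
  lookup-reverseᵛ w = lookup∘tabulate (lookup w ∘ opposite)

  At-determined : ∀ {i} {xs : List ℕ} → entries v ≡ xs → ∀ {j x} → toℕ i ≡ j → At xs j x →
                  toℕ (lookup v i) ≡ x
  At-determined {v = v} {i} refl refl p = At-functional (At-entries v i) p

  entries-≡ : ∀ {w : Arrangement (suc m)} {xs} → length xs ≡ suc m →
              (∀ i → At xs (toℕ i) (toℕ (lookup w i))) → entries w ≡ xs
  entries-≡ {w} len f = At-extensional (trans (length-entries w) (sym len)) λ p → lemma (At-entries⁻ w p)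
    where
    lemma : ∀ {i x} → (∃ λ j → i ≡ toℕ j × x ≡ toℕ (lookup w j)) → At _ i x
    lemma (j , refl , refl) = f j

  entries-reverseᵛ : ∀ w → entries (reverseᵛ w) ≡ reverse (entries w)
  entries-reverseᵛ w = entries-≡ (trans (length-reverse (entries w)) (length-entries w)) λ i →
    subst₂ (At (reverse (entries w))) (index i) (cong toℕ (sym (lookup-reverseᵛ w i)))
      (At-reverse (At-entries w (opposite i)))
    where
    index : ∀ i → length (entries w) ∸ suc (toℕ (opposite i)) ≡ toℕ i
    index i = trans (cong (_∸ suc (toℕ (opposite i))) (length-entries w))
      (trans (sym (opposite-prop (opposite i))) (cong toℕ (opposite-involutive i)))

  entries-rotate⁻ : ∀ xs ys → entries v ≡ xs ++ ys → entries w ≡ ys ++ xs →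
                    ∀ i → lookup w i ≡ lookup v (i ⊕ length xs)
  entries-rotate⁻ {v} {w} xs ys ev ew i = toℕ-injective (sym (At-determined {v = v} ev
    (toℕ-⊕ i (length xs))
    (At-rotate xs ys (trans (cong length (sym ev)) (length-entries v))
      (subst (λ us → At us (toℕ i) (toℕ (lookup w i))) ew (At-entries w i)))))

  entries-rotate⁺ : ∀ k → (∀ i → lookup w i ≡ lookup v (i ⊕ toℕ k)) → entries v ≈ᵣ entries w
  entries-rotate⁺ {w} {v} k eq = subst₂ _≈ᵣ_ ev (sym ew) (rotate front back)
    where
    front = take (toℕ k) (entries v)
    back = drop (toℕ k) (entries v)
    ev : front ++ back ≡ entries v
    ev = take++drop≡id (toℕ k) (entries v)
    len : length front ≡ toℕ k
    len = trans (length-take (toℕ k) (entries v)) (m≤n⇒m⊓n≡m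
      (subst (toℕ k ≤_) (sym (length-entries v)) (<⇒≤ (toℕ<n k))))
    lenᵣ : length (back ++ front) ≡ suc m
    lenᵣ = trans (length-++ back) (trans (+-comm (length back) (length front))
      (trans (sym (length-++ front)) (trans (cong length ev) (length-entries v))))
    ew : entries w ≡ back ++ front
    ew = entries-≡ lenᵣ λ i →
      let z , p = At-total (subst (toℕ i <_) (sym lenᵣ) (toℕ<n i)) in
      subst (At (back ++ front) (toℕ i))
        (sym (trans (cong toℕ (eq i)) (At-determined {v = v} (sym ev)
          (trans (toℕ-⊕ i (toℕ k)) (cong (λ k → (toℕ i + k) % suc m) (sym len)))
          (At-rotate front back (trans (cong length ev) (length-entries v)) p))))
        p

  entries-≈ᵣ⁻ : entries v ≈ᵣ entries w →
                ∃ λ (k : Fin (suc m)) → ∀ i → lookup w i ≡ lookup v (i ⊕ toℕ k)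
  entries-≈ᵣ⁻ {v} {w} p = go p refl refl
    where
    go : ∀ {us vs} → us ≈ᵣ vs → entries v ≡ us → entries w ≡ vs →
         ∃ λ (k : Fin (suc m)) → ∀ i → lookup w i ≡ lookup v (i ⊕ toℕ k)
    -- Here `length xs` is the full length, which is no element of `Fin (suc m)`; the same rotation
    -- is the one by 0.
    go (rotate xs []) ev ew = Fin.zero ,
      entries-rotate⁻ {v} {w} [] xs (trans ev (++-identityʳ xs)) (trans ew (sym (++-identityʳ xs)))
    go (rotate xs ys@(y ∷ ys′)) ev ew = fromℕ< small , λ i →
      trans (entries-rotate⁻ {v} {w} xs ys ev ew i)
        (cong (λ k → lookup v (i ⊕ k)) (sym (toℕ-fromℕ< small)))
      where
      small : length xs < suc m
      small = subst (length xs <_)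
                (trans (sym (length-++ xs)) (trans (cong length (sym ev)) (length-entries v)))
                (m<m+n (length xs) z<s)

  ≈⇒~ : ∀ v w → v ≈ w → entries v ~ entries w
  ≈⇒~ v w (k , inj₁ eq) = rotation (entries-rotate⁺ k eq)
  -- Reflected indices of `w` are plain indices of `reverseᵛ w`, which is therefore a rotation of
  -- `v`.
  ≈⇒~ v w (k , inj₂ eq) = reflection (subst (entries v ≈ᵣ_) (entries-reverseᵛ w)
    (entries-rotate⁺ k λ i → trans (lookup-reverseᵛ w i) (trans (eq (opposite i))
      (cong (λ j → lookup v (j ⊕ toℕ k)) (opposite-involutive i)))))

  ~⇒≈ : ∀ v w → entries v ~ entries w → v ≈ w
  ~⇒≈ v w (rotation p) with k , eq ← entries-≈ᵣ⁻ {v} {w} p = k , inj₁ eq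
  ~⇒≈ v w (reflection p)
    with k , eq ← entries-≈ᵣ⁻ {v} {reverseᵛ w}
           (subst (entries v ≈ᵣ_) (sym (entries-reverseᵛ w)) p)
    = k , inj₂ λ i → trans (cong (lookup w) (sym (opposite-involutive i)))
            (trans (sym (lookup-reverseᵛ w (opposite i))) (eq (opposite i)))

-- Necklaces as cyclic lists without links

open IsNecklace

-- Cyclic succession by positions, as in `IsNecklace`, with `suc m` as the length; it is oriented,
-- whereas `Adj` is symmetric.
Next : ℕ → List ℕ → ℕ → ℕ → Set
Next m xs x y = ∃ λ i → At xs i x × At xs ((i + 1) % suc m) y

last+1≡0 : ∀ m → (m + 1) % suc m ≡ 0
last+1≡0 m = trans (cong (_% suc m) (+-comm m 1)) (n%n≡0 (suc m))

inner+1 : ∀ {m i} → suc i < suc m → (i + 1) % suc m ≡ suc i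
inner+1 {m} {i} si<n = trans (cong (_% suc m) (+-comm i 1)) (m<n⇒m%n≡m si<n)

At-last : ∀ (us : List ℕ) y {m} → length (us ∷ʳ y) ≡ suc m → At (us ∷ʳ y) m y
At-last []           y         refl = here
At-last (_ ∷ us)     y {suc m} len  = there (At-last us y (suc-injective len))
At-last (_ ∷ [])     y {zero}  ()
At-last (_ ∷ _ ∷ _)  y {zero}  ()

module _ {m : ℕ} (1≤m : 1 ≤ m) {xs : List ℕ} (len : length xs ≡ suc m) where

  private
    view = ∷-∷ʳ-view xs (subst (2 ≤_) (sym len) (s≤s 1≤m))

    consecutive : ∀ {x y} → Consecutive x y xs → Next m xs x y
    consecutive {y = y} c with i , p , q ← Consecutive⇒At c =
      i , p , subst (λ j → At xs j y) (sym (inner+1 (subst (suc i <_) len (At-< q)))) q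

    around : ∀ {a us b} → xs ≡ a ∷ us ∷ʳ b → Next m xs b a
    around {a} {us} {b} refl =
      m , At-last (a ∷ us) b len , subst (λ j → At xs j a) (sym (last+1≡0 m)) here

  Adj⇒Next : ∀ {x y} → Adj xs x y → Next m xs x y ⊎ Next m xs y x
  Adj⇒Next {x} {y} adj with a , us , b , eq ← view
    with Adj-cases (subst (λ xs → Adj xs x y) eq adj)
  ... | inj₁ (inj₁ c)             = inj₁ (consecutive (subst (Consecutive x y) (sym eq) c))
  ... | inj₁ (inj₂ c)             = inj₂ (consecutive (subst (Consecutive y x) (sym eq) c))
  ... | inj₂ (inj₁ (refl , refl)) = inj₂ (around eq)
  ... | inj₂ (inj₂ (refl , refl)) = inj₁ (around eq)

  Next⇒Adj : ∀ {x y} → Next m xs x y → Adj xs x y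
  Next⇒Adj {x} {y} (i , p , q) with m≤n⇒m<n∨m≡n (subst (i <_) len (At-< p))
  ... | inj₁ si<n = Consecutive⇒Adj (At-consecutive p (subst (λ j → At xs j y) (inner+1 si<n) q))
  ... | inj₂ refl with a , us , b , refl ← view
    with refl ← At-functional p (At-last (a ∷ us) b len)
       | refl ← At-functional (subst (λ j → At xs j y) (last+1≡0 m) q) here
    = Adj-sym (Adj-∷-∷ʳ a us b)

module _ {m : ℕ} {v : Arrangement (suc m)} where

  necklace⇒linked : IsNecklace 1 4 v → Linked [] (suc m) (entries v)
  necklace⇒linked K = record
    { size     = length-entries v
    ; unique   = At-injective⇒Unique λ p q → injective (At-entries⁻ v p) (At-entries⁻ v q)
    ; bounded  = All.tabulate λ x∈ → bound (At-entries⁻ v (proj₂ (∈⇒At x∈)))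
    ; covers   = cover
    ; allowed  = λ adj → inj₂ (near (Adj⇒Next (s<s⁻¹ (<⇒≤ (length≥3 K))) (length-entries v) adj))
    ; required = λ { (inj₁ ()) ; (inj₂ ()) }
    }
    where
    injective : ∀ {i j x} → (∃ λ k → i ≡ toℕ k × x ≡ toℕ (lookup v k)) →
                (∃ λ k → j ≡ toℕ k × x ≡ toℕ (lookup v k)) → i ≡ j
    injective (k , refl , refl) (l , refl , eq) with _ , _ , u ← usesEachOnce K (lookup v k) =
      cong toℕ (trans (sym (u refl)) (u (toℕ-injective (sym eq))))
    bound : ∀ {i x} → (∃ λ k → i ≡ toℕ k × x ≡ toℕ (lookup v k)) → x < suc m
    bound (k , _ , refl) = toℕ<n (lookup v k)
    cover : ∀ {x} → x < suc m → x ∈ entries v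
    cover x<n with k , eq , _ ← usesEachOnce K (fromℕ< x<n) =
      subst (_∈ entries v) (trans (cong toℕ eq) (toℕ-fromℕ< x<n)) (At⇒∈ (At-entries v k))
    next : ∀ {x y} → Next m (entries v) x y → Near x y
    next {x} {y} (i , p , q) with k , refl , refl ← At-entries⁻ v p =
      subst (Near x) (At-determined {v = v} refl (toℕ-⊕ k 1) q) (adjacent K k)
    near : ∀ {x y} → Next m (entries v) x y ⊎ Next m (entries v) y x → Near x y
    near         (inj₁ n) = next n
    near {x} {y} (inj₂ n) = subst (λ d → d ≡ 1 ⊎ d ≡ 4) (∣-∣-comm y x) (next n)

  linked⇒necklace : 3 ≤ suc m → Linked [] (suc m) (entries v) → IsNecklace 1 4 v
  linked⇒necklace 3≤n L = isNecklace 3≤n once adj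
    where
    once : UsesEachOnce v
    once x with i , p ← ∈⇒At (covers L (toℕ<n x))
      with k , refl , eq ← At-entries⁻ v p
      = k , toℕ-injective (sym eq) , λ { {l} refl → toℕ-injective
          (Unique⇒At-injective (unique L) p (At-entries v l)) }
    adj : ∀ i → Compatible 1 4 (lookup v i) (lookup v (i ⊕ 1))
    adj i with allowed L (Next⇒Adj (s<s⁻¹ (<⇒≤ 3≤n)) (length-entries v)
      (toℕ i , At-entries v i ,
       subst (λ j → At (entries v) j (toℕ (lookup v (i ⊕ 1)))) (toℕ-⊕ i 1) (At-entries v (i ⊕ 1))))
    ... | inj₂ near = near
    ... | inj₁ (inj₁ ())
    ... | inj₁ (inj₂ ())

≈-isEquivalence : ∀ {m} → IsEquivalence (_≈_ {suc m})
≈-isEquivalence = record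
  { refl  = λ {v} → ~⇒≈ v v ~-refl
  ; sym   = λ {v} {w} p → ~⇒≈ w v (~-sym (≈⇒~ v w p))
  ; trans = λ {u} {v} {w} p q → ~⇒≈ u w (~-trans (≈⇒~ u v p) (≈⇒~ v w q))
  }

∈-allVecs : ∀ {n k} (v : Vec (Fin n) k) → v ∈ allVecs n k
∈-allVecs []      = here refl
∈-allVecs (x ∷ v) = ∈-cartesianProductWith⁺ _∷_ (∈-allFin x) (∈-allVecs v)

-- The classes of necklaces are enumerated twice, by deduplicating all of them and by pulling back
-- along `entries`; the two sizes agree.
N≡count : ∀ k → N 1 4 (3 + k) ≡ count-∅ k
N≡count k = Enumerates-unique ≈-isEquivalence
  (deduplicate-enumerates ≈-isEquivalence _≈?_
    (All.all-filter (isNecklace? 1 4) (allVecs (3 + k) (3 + k)))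
    (λ {v} → ∈-filter⁺ (isNecklace? 1 4) (∈-allVecs v)))
  (Enumerates-pullback ~-isEquivalence entries necklace⇒linked
    (λ {v} {w} _ _ → ≈⇒~ v w) (λ {v} {w} _ _ → ~⇒≈ v w)
    realise (count-enumerates k []))
  where
  realise : ∀ {xs} → Linked [] (3 + k) xs → ∃ λ v → IsNecklace 1 4 v × entries v ~ xs
  realise L with v , refl ← entries-surjective (3 + k) _ (size L) (bounded L) =
    v , linked⇒necklace (s≤s (s≤s (s≤s z≤n))) L , ~-refl

-- The recurrence and the initial values

recurrence : (A C D : ℕ → ℕ) → (∀ k → A (2 + k) ≡ C k + D k) →
             (∀ k → C (5 + k) ≡ A (4 + k) + C k) → (∀ k → D (3 + k) ≡ A k + D (1 + k)) →
             ∀ k → A (13 + k) ≡ A (10 + k) + A (8 + k) + A (6 + k) + A (5 + k)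
                              + A (4 + k) + A (3 + k) + A (2 + k) + A k
recurrence A C D A-step C-step D-step k
  -- Unfolding `C (11 + k)` twice and `D (11 + k)` five times leaves `C (1 + k) + D (1 + k)`, which
  -- is `A (3 + k)`.
  rewrite A-step (11 + k) | C-step (6 + k) | C-step (1 + k)
        | D-step (8 + k) | D-step (6 + k) | D-step (4 + k) | D-step (2 + k) | D-step k | A-step (1 + k)
  = solve 9 (λ a₁₀ a₈ a₆ a₅ a₄ a₂ a₀ c₁ d₁ →
      a₁₀ :+ (a₅ :+ c₁) :+ (a₈ :+ (a₆ :+ (a₄ :+ (a₂ :+ (a₀ :+ d₁)))))
      := a₁₀ :+ a₈ :+ a₆ :+ a₅ :+ a₄ :+ (c₁ :+ d₁) :+ a₂ :+ a₀) refl
      (A (10 + k)) (A (8 + k)) (A (6 + k)) (A (5 + k)) (A (4 + k)) (A (2 + k)) (A k) (C (1 + k)) (D (1 + k))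
  where open +-*-Solver

Recurrence : (ℕ → ℕ) → Set
Recurrence M = ∀ n → 16 ≤ n →
  M n ≡ M (n ∸ 3) + M (n ∸ 5) + M (n ∸ 7) + M (n ∸ 8)
      + M (n ∸ 9) + M (n ∸ 10) + M (n ∸ 11) + M (n ∸ 13)

-- Stated for an abstract M: with N 1 4 in its place, comparing the sums makes Agda
-- evaluate N on open terms.
Recurrence-shifted : (M A : ℕ → ℕ) → (∀ k → M (3 + k) ≡ A k) →
  (∀ k → A (13 + k) ≡ A (10 + k) + A (8 + k) + A (6 + k) + A (5 + k)
                    + A (4 + k) + A (3 + k) + A (2 + k) + A k) →
  Recurrence M
Recurrence-shifted M A M≡A rec n 16≤n = subst
  (λ n → M n ≡ M (n ∸ 3) + M (n ∸ 5) + M (n ∸ 7) + M (n ∸ 8)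
               + M (n ∸ 9) + M (n ∸ 10) + M (n ∸ 11) + M (n ∸ 13))
  (m+[n∸m]≡n 16≤n) (shifted (n ∸ 16))
  where
  infixl 6 _⊞_
  _⊞_ : ∀ {a b c d} → a ≡ b → c ≡ d → a + c ≡ b + d
  _⊞_ = cong₂ _+_
  shifted : ∀ k → M (16 + k) ≡ M (13 + k) + M (11 + k) + M (9 + k) + M (8 + k)
                             + M (7 + k) + M (6 + k) + M (5 + k) + M (3 + k)
  shifted k = trans (M≡A (13 + k)) (trans (rec k) (sym
    (M≡A (10 + k) ⊞ M≡A (8 + k) ⊞ M≡A (6 + k) ⊞ M≡A (5 + k)
     ⊞ M≡A (4 + k) ⊞ M≡A (3 + k) ⊞ M≡A (2 + k) ⊞ M≡A k)))

-- The equation n ≡ 3 + k keeps n a literal, so that Agda does not evaluate N to match it.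
N-value : ∀ n k {c} → n ≡ 3 + k → count-∅ k ≡ c → N 1 4 n ≡ c
N-value n k refl = trans (N≡count k)

mainTheorem6 : (∀ (n : ℕ) → 16 ≤ n →
    N 1 4 n ≡ N 1 4 (n ∸ 3) + N 1 4 (n ∸ 5) + N 1 4 (n ∸ 7) + N 1 4 (n ∸ 8)
    + N 1 4 (n ∸ 9) + N 1 4 (n ∸ 10) + N 1 4 (n ∸ 11) + N 1 4 (n ∸ 13))
    × (∀ (n : ℕ) → n < 5 → N 1 4 n ≡ 0)
    × (N 1 4 5 ≡ 1)
    × (N 1 4 6 ≡ 0)
    × (N 1 4 7 ≡ 1)
    × (N 1 4 8 ≡ 1)
    × (N 1 4 9 ≡ 1)
    × (N 1 4 10 ≡ 3)
    × (N 1 4 11 ≡ 2)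
    × (N 1 4 12 ≡ 3)
    × (N 1 4 13 ≡ 6)
    × (N 1 4 14 ≡ 5)
    × (N 1 4 15 ≡ 10)
mainTheorem6 =
    Recurrence-shifted (N 1 4) count-∅ N≡count
      (recurrence count-∅ count-02 count-23 count-∅-step count-02-step count-23-step)
  , small
  , N-value 5 2 refl refl
  , N-value 6 3 refl refl
  , N-value 7 4 refl refl
  , N-value 8 5 refl refl
  , N-value 9 6 refl refl
  , N-value 10 7 refl refl
  , N-value 11 8 refl refl
  , N-value 12 9 refl refl
  , N-value 13 10 refl refl
  , N-value 14 11 refl refl
  , N-value 15 12 refl refl
  where
  small : ∀ n → n < 5 → N 1 4 n ≡ 0
  -- Below length 3 the arrangements are few and all fail `length≥3`, so `N` is evaluated directly.
  small 0 _ = refl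
  small 1 _ = refl
  small 2 _ = refl
  small 3 _ = N-value 3 0 refl refl
  small 4 _ = N-value 4 1 refl refl
  small (suc (suc (suc (suc (suc _))))) (s≤s (s≤s (s≤s (s≤s (s≤s ())))))
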